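{- Let $p$ be an odd prime, let $d$ be a positive integer, and let $q=p^d$. Let $S$ be an SLCE almost difference set over $\mathbb{F}_q$. Let $T$ be a set of distinct coset representatives of $\langle p\rangle$ in $(\mathbb{Z}/(q-1)\mathbb{Z})^*$, and let $t\in T$ be a multiplier of $S$. Then the sets $$S_0=\left\{ j\in T :\ d-\sum_{i=0}^{d-1}\left( \left\lfloor \frac{2(j^{ -1})'p^i}{q-1}\right\rfloor-2\left\lfloor\frac{(j^{ -1})'p^i}{q-1}\right\rfloor\right)>0\right\}$$ and $tS_0=\{tj : j\in S_0\}$ are either identical or disjoint.
   Context: SLCE almost difference set: let $q$ be a power of an odd prime and $\alpha$ a primitive element of $\mathbb{F}_q$. The Sidelnikov-Lempel-Cohn-Eastman (SLCE) sequence $\mathbf{s}=s_0s_1s_2\ldots$ defined using $\alpha$ is the binary sequence, periodic with $s_{j+q-1}=s_j$, given for $0\le j<q-1$ by $s_j=0$ if $\alpha^j+1$ is $0$ or a nonzero square in $\mathbb{F}_q$, and $s_j=1$ if $\alpha^j+1$ is a nonsquare in $\mathbb{F}_q$. The corresponding SLCE almost difference set is $S=\{j\in\mathbb{Z}/(q-1)\mathbb{Z} : s_j=1\}$ (equivalently, via $j\mapsto\alpha^j$, a subset of the cyclic group $\mathbb{F}_q^*$). Multipliers: a residue $t\in(\mathbb{Z}/(q-1)\mathbb{Z})^*$ is a multiplier of $S$ if there is $c\in\mathbb{Z}/(q-1)\mathbb{Z}$ with $\{tj : j\in S\}=\{j+c : j\in S\}$. For a residue class $r\in\mathbb{Z}/n\mathbb{Z}$,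 $r'$ denotes the least positive integer in the class $r$; $j^{ -1}$ is the inverse of $j$ in $(\mathbb{Z}/(q-1)\mathbb{Z})^*$. $\langle p\rangle$ is the subgroup of $(\mathbb{Z}/(q-1)\mathbb{Z})^*$ generated by the class of $p$. Products $tj$ are taken in $(\mathbb{Z}/(q-1)\mathbb{Z})^*$. -}

module Defs where

open import Algebra.Bundles using (CommutativeRing)
import Algebra.Definitions as AlgDefs
import Algebra.Properties.Semiring.Exp as Exp
open import Data.Bool.Base using (if_then_else_)
open import Data.Fin.Base using (Fin; zero; suc; toℕ)
import Data.Fin.Properties as Fin
open import Data.Integer.Base as ℤ using (ℤ; +_)
import Data.Integer.Properties as ℤ
open import Algebra.Properties.Monoid.Sum ℤ.+-0-monoid using (sum-syntax)
open import Data.Nat.Base hiding (_⊔_)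
open import Data.Nat.DivMod using (_/_; _%_; _mod_)
open import Data.Nat.Primality using (Prime; prime⇒nonTrivial)
import Data.Nat.Properties as ℕ
open import Data.Product.Base using (Σ; ∃-syntax; _×_; _,_; proj₁)
open import Data.Sum.Base using (_⊎_)
open import Function.Bundles using (Inverse)
open import Function.Properties.Inverse using (Inverse⇒Injection)
open import Level using (Level; _⊔_) renaming (suc to lsuc)
open import Relation.Binary.Definitions using (Decidable)
open import Relation.Binary.PropositionalEquality as ≡ using (_≡_)
open import Relation.Nullary.Decidable
  using (Dec; map′; does; via-injection; _×-dec_; _⊎-dec_; ¬?)
open import Relation.Unary using (Pred; _∈_; _⊆_; _≐_)

private
  variable
    a b ℓ : Level

Image : {A : Set a} {B : Set b} → (A → B) → Pred A ℓ → Pred B (a ⊔ b ⊔ ℓ)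
Image f P y = ∃[ x ] (x ∈ P × f x ≡ y)

-- Equality is the setoid equality _≈_; being in bijection with Fin q makes it
-- decidable, so the inequality x ≉ 0# carries no constructive subtlety.
record FiniteField c ℓ (q : ℕ) : Set (lsuc (c ⊔ ℓ)) where
  field
    commutativeRing : CommutativeRing c ℓ

  open CommutativeRing commutativeRing public hiding (zero)
    renaming (_+_ to _+ᶠ_; _*_ to _*ᶠ_)
  open AlgDefs _≈_ using (Invertible)
  open Exp semiring public using () renaming (_^_ to _^ᶠ_)

  field
    1≉0            : 1# ≉ 0#
    ≉0⇒invertible  : ∀ {x} → x ≉ 0# → Invertible 1# _*ᶠ_ x
    enumeration    : Inverse setoid (≡.setoid (Fin q))

  private module E = Inverse enumeration

  _≈?_ : Decidable _≈_
  _≈?_ = via-injection (Inverse⇒Injection enumeration) Fin._≟_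

  NonzeroSquare : Carrier → Set (c ⊔ ℓ)
  NonzeroSquare x = x ≉ 0# × (∃[ y ] y *ᶠ y ≈ x)

  nonzeroSquare? : ∀ x → Dec (NonzeroSquare x)
  nonzeroSquare? x = ¬? (x ≈? 0#) ×-dec map′
    (λ (i , eq) → E.from i , eq)
    (λ (y , eq) → E.to y , trans (*-cong (E.strictlyInverseʳ y) (E.strictlyInverseʳ y)) eq)
    (Fin.any? λ i → (E.from i *ᶠ E.from i) ≈? x)

  Primitive : Carrier → Set (c ⊔ ℓ)
  Primitive α = α ≉ 0# × (∀ x → x ≉ 0# → ∃[ j ] α ^ᶠ j ≈ x)

-- ℤ/nℤ is represented by its canonical residues 0, …, n - 1.
module Residues (n : ℕ) .{{_ : NonZero n}} where

  infixl 6 _⊕_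
  infixl 7 _⊗_

  _⊕_ _⊗_ : Fin n → Fin n → Fin n
  i ⊕ j = (toℕ i + toℕ j) mod n
  i ⊗ j = (toℕ i * toℕ j) mod n

  𝟙 : Fin n
  𝟙 = 1 mod n

  open AlgDefs (_≡_ {A = Fin n}) using (Invertible)

  IsUnit : Pred (Fin n) _
  IsUnit = Invertible 𝟙 _⊗_

  -- Least positive representative: that of the class 0 is n, not 0.
  leastPositive : Fin n → ℕ
  leastPositive r with toℕ r
  ... | zero  = n
  ... | suc k = suc k

  IsMultiplier : Pred (Fin n) ℓ → Pred (Fin n) _
  IsMultiplier S t =
    IsUnit t × (∃[ c ] Image (t ⊗_) S ≐ Image (_⊕ c) S)

  -- Intended for a unit g: the subgroup of (ℤ/nℤ)* generated by g.
  data ⟨_⟩ (g : Fin n) : Pred (Fin n) Level.zero where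
    generator : g ∈ ⟨ g ⟩
    identity  : 𝟙 ∈ ⟨ g ⟩
    product   : ∀ {i j} → i ∈ ⟨ g ⟩ → j ∈ ⟨ g ⟩ → i ⊗ j ∈ ⟨ g ⟩
    inverse   : ∀ {i} → i ∈ ⟨ g ⟩ → (u : IsUnit i) → proj₁ u ∈ ⟨ g ⟩

  SameCoset : (g i j : Fin n) → Set
  SameCoset g i j = ∃[ h ] (h ∈ ⟨ g ⟩ × i ⊗ h ≡ j)

  record IsCosetRepresentatives (g : Fin n) (T : Pred (Fin n) ℓ) : Set ℓ where
    field
      units    : T ⊆ IsUnit
      covers   : ∀ {u} → IsUnit u → ∃[ i ] (i ∈ T × SameCoset g i u)
      distinct : ∀ {i j} → i ∈ T → j ∈ T → SameCoset g i j → i ≡ j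

module SLCE (p d : ℕ) (p-prime : Prime p) (d>0 : 0 < d) where

  q n : ℕ
  q = p ^ d
  n = q ∸ 1

  instance
    n-nonZero : NonZero n
    n-nonZero = >-nonZero (ℕ.m<n⇒0<n∸m (ℕ.^-monoʳ-< p 1<p d>0))
      where 1<p = nonTrivial⇒n>1 p {{prime⇒nonTrivial p-prime}}

  open Residues n public

  module _ {c ℓ} (F : FiniteField c ℓ q) (α : FiniteField.Carrier F) where
    private module F = FiniteField F

    slceSequence : ℕ → ℕ
    slceSequence j = if does ((x F.≈? F.0#) ⊎-dec F.nonzeroSquare? x) then 0 else 1
      where x = (α F.^ᶠ (j % n)) F.+ᶠ F.1#

    slceSet : Pred (Fin n) Level.zero
    slceSet j = slceSequence (toℕ j) ≡ 1

  -- Each summand is 1 if the fractional part of a pⁱ / (q - 1) is at least 1/2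
  -- and 0 otherwise, so this counts the i with fractional part below 1/2.
  defect : ℕ → ℤ
  defect a = + d ℤ.- (∑[ i < d ]
    (+ (2 * a * p ^ toℕ i / n) ℤ.- + 2 ℤ.* + (a * p ^ toℕ i / n)))

  S₀ : Pred (Fin n) ℓ → Pred (Fin n) ℓ
  S₀ T j = j ∈ T × Σ (IsUnit j) λ (j⁻¹ , _) → defect (leastPositive j⁻¹) ℤ.> + 0

{-# OPTIONS --safe #-}

-- Over 𝔽_q, reduce the Fourier coefficients of the sequence s modulo p: put
-- P(k) = Σ_j s_j α^(j k).  By Euler's criterion 2 s_j = 1 - (α^j + 1)^((q-1)/2) - [α^j = -1],
-- and expanding (x + 1)^((q-1)/2) = ∏_i (x^(p^i) + 1)^h with h = (p-1)/2 gives, with n = q - 1,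
-- 2 P(a) = c(n - a) - (-1)^a, where c(k) ≠ 0 exactly when all base p digits of k are at most h.
-- A multiplier t with tS = S + c yields P(t k) = γ^k P(k) for γ = α^c.
--
-- If j and tj both lie in S₀, then w = j⁻¹ and v = (tj)⁻¹ have positive defect, so
-- c(n - w) = c(n - v) = 0 and 2 P(w) = 2 P(v) = 1; since w = t v, this forces γ^v = 1 and γ = 1.
-- Hence multiplication by t modulo n preserves the set of k all of whose digits are at most h.
-- Multiplying t by 1, …, h shows that its digits are at most 1, and multiplying it by
-- h + h p^k that only one of them is nonzero.  So t is a power of p, j and tj represent the
-- same coset of ⟨p⟩, and t = 1.  Thus S₀ and tS₀ are disjoint unless t = 1.

module Submission where

open import Defs
open import Algebra.Bundles using (CommutativeRing)
import Algebra.Properties.CommutativeSemigroup as CommutativeSemigroupProperties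
import Algebra.Properties.CommutativeSemiring.Binomial as Binomial
import Algebra.Properties.CommutativeSemiring.Exp as CommutativeExp
import Algebra.Properties.Ring as RingProperties
import Algebra.Properties.Semiring.Exp as Exp
import Algebra.Properties.Semiring.Mult as Mult
import Algebra.Properties.Semiring.Sum as Sum
open import Data.Bool.Base using (true; false; if_then_else_)
open import Data.Fin.Base using (Fin; zero; suc; toℕ)
import Data.Fin.Permutation as Permutation
import Data.Fin.Properties as Fin
import Data.Integer.Base as ℤ
import Data.Integer.Properties as ℤ
import Algebra.Properties.Monoid.Sum ℤ.+-0-monoid as ℤSum
open import Data.Nat.Base hiding (_⊔_)
open import Data.Nat.Combinatorics using (_C_; nC1≡n; nCn≡1; k>n⇒nCk≡0; nCk+nC[k+1]≡[n+1]C[k+1])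
open import Data.Nat.Coprimality using (Coprime; coprime-Bézout)
open import Data.Nat.Divisibility
open import Data.Nat.DivMod
open import Data.Nat.GCD using (module Bézout)
open import Data.Nat.Primality
  using (Prime; euclidsLemma; prime⇒irreducible; prime⇒nonTrivial; prime⇒nonZero)
import Data.Nat.Properties as ℕ
open import Data.Nat.Tactic.RingSolver using (solve-∀)
open import Data.Product.Base using (∃-syntax; _×_; _,_; proj₁; proj₂)
open import Data.Sum.Base using (_⊎_; inj₁; inj₂; [_,_]′)
open import Function.Base using (_∘_)
open import Function.Bundles using (Inverse)
open import Relation.Binary.Definitions using (tri<; tri≈; tri>)
open import Relation.Binary.PropositionalEquality as ≡ using (_≡_)
import Relation.Binary.Reasoning.Setoid as ≈-Reasoning
open import Relation.Nullary.Decidable using (Dec; yes; no; does; _⊎-dec_; dec-true; dec-false)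
open import Relation.Nullary.Negation using (¬_; contradiction)
open import Relation.Unary using (Pred; _∈_; _≐_; _⊥_)

-- Binomial coefficients modulo a prime and base `p` digits.

module Digits where
  open import Data.Nat.Properties
  open ≡

  -- The absorption identity, from Pascal's rule. With Euclid's lemma it settles divisibility of
  -- binomial coefficients by `p` without factorials.
  [1+k]*[1+n]C[1+k]≡[1+n]*nCk : ∀ n k → suc k * (suc n C suc k) ≡ suc n * (n C k)
  [1+k]*[1+n]C[1+k]≡[1+n]*nCk zero zero = refl
  [1+k]*[1+n]C[1+k]≡[1+n]*nCk zero (suc k)
    rewrite k>n⇒nCk≡0 {1} {suc (suc k)} (s≤s (s≤s z≤n)) | k>n⇒nCk≡0 {0} {suc k} (s≤s z≤n) = *-zeroʳ k
  [1+k]*[1+n]C[1+k]≡[1+n]*nCk (suc n) zero = begin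
    1 * (suc (suc n) C 1) ≡⟨ *-identityˡ _ ⟩
    suc (suc n) C 1       ≡⟨ nC1≡n (suc (suc n)) ⟩
    suc (suc n)           ≡⟨ *-identityʳ _ ⟨
    suc (suc n) * 1       ∎
    where open ≡-Reasoning
  [1+k]*[1+n]C[1+k]≡[1+n]*nCk (suc n) (suc k) = begin
    suc (suc k) * (suc (suc n) C suc (suc k))  ≡⟨ cong (suc (suc k) *_) (nCk+nC[k+1]≡[n+1]C[k+1] (suc n) (suc k)) ⟨
    suc (suc k) * (A + D)                      ≡⟨ lemma k A D ⟩
    A + suc k * A + suc (suc k) * D            ≡⟨ cong₂ (λ x y → A + x + y) ([1+k]*[1+n]C[1+k]≡[1+n]*nCk n k)
                                                    ([1+k]*[1+n]C[1+k]≡[1+n]*nCk n (suc k)) ⟩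
    A + suc n * (n C k) + suc n * (n C suc k)  ≡⟨ +-assoc A _ _ ⟩
    A + (suc n * (n C k) + suc n * (n C suc k)) ≡⟨ cong (A +_) (*-distribˡ-+ (suc n) (n C k) (n C suc k)) ⟨
    A + suc n * (n C k + n C suc k)            ≡⟨ cong (λ x → A + suc n * x) (nCk+nC[k+1]≡[n+1]C[k+1] n k) ⟩
    suc (suc n) * A                            ∎
    where
    open ≡-Reasoning
    A = suc n C suc k
    D = suc n C suc (suc k)
    lemma : ∀ k A D → suc (suc k) * (A + D) ≡ A + suc k * A + suc (suc k) * D
    lemma = solve-∀

  p∣pCk : ∀ {p k} → Prime p → 0 < k → k < p → p ∣ p C k
  p∣pCk {suc p} {suc k} p-prime _ k<p
    with euclidsLemma (suc k) (suc p C suc k) p-prime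
           (divides (p C k) (trans ([1+k]*[1+n]C[1+k]≡[1+n]*nCk p k) (*-comm (suc p) (p C k))))
  ... | inj₁ p∣k = contradiction p∣k (>⇒∤ k<p)
  ... | inj₂ p∣C = p∣C

  p∤nCk : ∀ {p n k} → Prime p → n < p → k ≤ n → ¬ p ∣ n C k
  p∤nCk {p} {n} {zero} p-prime _ _ p∣1 =
    >⇒∤ (nonTrivial⇒n>1 p {{prime⇒nonTrivial p-prime}}) p∣1
  p∤nCk {p} {suc n} {suc k} p-prime n<p (s≤s k≤n) p∣C
    with euclidsLemma (suc n) (n C k) p-prime
           (subst (p ∣_) ([1+k]*[1+n]C[1+k]≡[1+n]*nCk n k) (∣n⇒∣m*n (suc k) p∣C))
  ... | inj₁ p∣n = >⇒∤ n<p p∣n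
  ... | inj₂ p∣C = p∤nCk p-prime (<-trans (n<1+n n) n<p) k≤n p∣C

  _≤_upTo_ : (ℕ → ℕ) → ℕ → ℕ → Set
  f ≤ b upTo e = ∀ i → i < e → f i ≤ b

  module Base (p : ℕ) .{{_ : NonZero p}} where

    -- Little-endian evaluation in base `p`. Entries may exceed `p - 1`, so digit functions can be
    -- added and scaled entrywise before carries are ruled out.
    value : ℕ → (ℕ → ℕ) → ℕ
    value zero    f = 0
    value (suc e) f = f 0 + p * value e (f ∘ suc)

    digit : ℕ → ℕ → ℕ
    digit k zero    = k % p
    digit k (suc i) = digit (k / p) i

    digit<p : ∀ k i → digit k i < p
    digit<p k zero    = m%n<n k p
    digit<p k (suc i) = digit<p (k / p) i

    value-digit : ∀ e {k} → k < p ^ e → value e (digit k) ≡ k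
    value-digit zero    k<1 = sym (n<1⇒n≡0 k<1)
    value-digit (suc e) {k} k<p^e = begin
      k % p + p * value e (digit (k / p)) ≡⟨ cong (λ x → k % p + p * x) (value-digit e (m<n*o⇒m/o<n (subst (k <_) (*-comm p (p ^ e)) k<p^e))) ⟩
      k % p + p * (k / p)                 ≡⟨ cong (k % p +_) (*-comm p (k / p)) ⟩
      k % p + (k / p) * p                 ≡⟨ m≡m%n+[m/n]*n k p ⟨
      k                                   ∎
      where open ≡-Reasoning

    value-+ : ∀ e f g → value e (λ i → f i + g i) ≡ value e f + value e g
    value-+ zero    f g = refl
    value-+ (suc e) f g = trans (cong (λ x → f 0 + g 0 + p * x) (value-+ e (f ∘ suc) (g ∘ suc)))
      (lemma (f 0) (g 0) p (value e (f ∘ suc)) (value e (g ∘ suc)))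
      where
      lemma : ∀ a b p x y → a + b + p * (x + y) ≡ a + p * x + (b + p * y)
      lemma = solve-∀

    value-* : ∀ e c f → value e (λ i → c * f i) ≡ c * value e f
    value-* zero    c f = sym (*-zeroʳ c)
    value-* (suc e) c f = trans (cong (λ x → c * f 0 + p * x) (value-* e c (f ∘ suc)))
      (lemma c (f 0) p (value e (f ∘ suc)))
      where
      lemma : ∀ c a p x → c * a + p * (c * x) ≡ c * (a + p * x)
      lemma = solve-∀

    value-zero : ∀ e {f} → f ≤ 0 upTo e → value e f ≡ 0
    value-zero zero    f≤0 = refl
    value-zero (suc e) f≤0 = cong₂ _+_ (n≤0⇒n≡0 (f≤0 0 z<s))
      (trans (cong (p *_) (value-zero e (λ i i<e → f≤0 (suc i) (s<s i<e)))) (*-zeroʳ p))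

    value-split : ∀ a b f → value (a + b) f ≡ value a f + p ^ a * value b (λ i → f (a + i))
    value-split zero    b f = sym (*-identityˡ _)
    value-split (suc a) b f = trans (cong (λ x → f 0 + p * x) (value-split a b (f ∘ suc)))
      (lemma (f 0) p (value a (f ∘ suc)) (p ^ a) (value b (λ i → f (suc a + i))))
      where
      lemma : ∀ c p x y z → c + p * (x + y * z) ≡ c + p * x + p * y * z
      lemma = solve-∀

    value-< : ∀ e {f} → (∀ i → i < e → f i < p) → value e f < p ^ e
    value-< zero    f<p = z<s
    value-< (suc e) {f} f<p = begin-strict
      f 0 + p * value e (f ∘ suc) <⟨ +-monoˡ-< _ (f<p 0 z<s) ⟩
      p + p * value e (f ∘ suc)   ≡⟨ *-suc p _ ⟨
      p * suc (value e (f ∘ suc)) ≤⟨ *-monoʳ-≤ p (value-< e (λ i i<e → f<p (suc i) (s<s i<e))) ⟩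
      p * p ^ e                   ∎
      where open ≤-Reasoning

    single : ℕ → ℕ → ℕ
    single c zero    = c
    single c (suc _) = 0

    single-≤ : ∀ c e → single c ≤ c upTo e
    single-≤ c e zero    _ = ≤-refl
    single-≤ c e (suc i) _ = z≤n

    value-single : ∀ e .{{_ : NonZero e}} c → value e (single c) ≡ c
    value-single (suc e) c =
      trans (cong (λ x → c + p * x) (value-zero e (λ _ _ → z≤n))) (trans (cong (c +_) (*-zeroʳ p)) (+-identityʳ c))

    splice : ℕ → (ℕ → ℕ) → (ℕ → ℕ) → ℕ → ℕ
    splice zero    f g i       = g i
    splice (suc k) f g zero    = f 0
    splice (suc k) f g (suc i) = splice k (f ∘ suc) g i

    value-splice : ∀ k e f g → value (k + e) (splice k f g) ≡ value k f + p ^ k * value e g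
    value-splice zero    e f g = sym (*-identityˡ _)
    value-splice (suc k) e f g = trans (cong (λ x → f 0 + p * x) (value-splice k e (f ∘ suc) g))
      (lemma (f 0) p (value k (f ∘ suc)) (p ^ k) (value e g))
      where
      lemma : ∀ c p x y z → c + p * (x + y * z) ≡ c + p * x + p * y * z
      lemma = solve-∀

    splice-+ : ∀ k f g i → splice k f g (k + i) ≡ g i
    splice-+ zero    f g i = refl
    splice-+ (suc k) f g i = splice-+ k (f ∘ suc) g i

    splice-≤ : ∀ k e {f g b} → f ≤ b upTo k → g ≤ b upTo e → splice k f g ≤ b upTo (k + e)
    splice-≤ zero    e f≤b g≤b i       i<e       = g≤b i i<e
    splice-≤ (suc k) e f≤b g≤b zero    _         = f≤b 0 z<s
    splice-≤ (suc k) e f≤b g≤b (suc i) (s<s i<e) =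
      splice-≤ k e (λ j j<k → f≤b (suc j) (s<s j<k)) g≤b i i<e

    -- The cyclic shift of `k + e` digits by `k` places, which is multiplication by `p ^ k` modulo
    -- `p ^ (k + e) - 1`.
    rotate : ℕ → ℕ → (ℕ → ℕ) → ℕ → ℕ
    rotate k e f = splice k (λ i → f (e + i)) f

    rotate-≤ : ∀ k e {f b} → f ≤ b upTo (k + e) → rotate k e f ≤ b upTo (k + e)
    rotate-≤ k e f≤b = splice-≤ k e
      (λ i i<k → f≤b (e + i) (subst (e + i <_) (+-comm e k) (+-monoʳ-< e i<k)))
      (λ i i<e → f≤b i (<-≤-trans i<e (m≤n+m e k)))

    -- The top `k` digits leave with weight `p ^ (k + e)` and re-enter at the bottom. The additive
    -- form avoids subtraction; cancelling their value yields the congruence modulo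
    -- `p ^ (k + e) - 1`.
    value-rotate : ∀ k e f → p ^ k * value (k + e) f + value k (λ i → f (e + i)) ≡
                   value (k + e) (rotate k e f) + p ^ (k + e) * value k (λ i → f (e + i))
    value-rotate k e f = begin
      p ^ k * value (k + e) f + y         ≡⟨ cong (λ m → p ^ k * value m f + y) (+-comm k e) ⟩
      p ^ k * value (e + k) f + y         ≡⟨ cong (λ v → p ^ k * v + y) (value-split e k f) ⟩
      p ^ k * (x + p ^ e * y) + y         ≡⟨ lemma (p ^ k) (p ^ e) x y ⟩
      y + p ^ k * x + p ^ k * p ^ e * y   ≡⟨ cong₂ (λ u v → u + v * y) (value-splice k e _ f) (^-distribˡ-+-* p k e) ⟨
      value (k + e) (rotate k e f) + p ^ (k + e) * y ∎
      where
      open ≡-Reasoning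
      x = value e f
      y = value k (λ i → f (e + i))
      lemma : ∀ a b x y → a * (x + b * y) + y ≡ y + a * x + a * b * y
      lemma = solve-∀

    value≡p^a : ∀ e f → f ≤ 1 upTo e →
                (∀ {i j} → i < j → j < e → f i ≡ 1 → ¬ f j ≡ 1) →
                value e f ≡ 0 ⊎ (∃[ a ] value e f ≡ p ^ a)
    value≡p^a zero    f f≤1 unique = inj₁ refl
    value≡p^a (suc e) f f≤1 unique with f 0 in f₀
    ... | suc (suc _) = contradiction (subst (_≤ 1) f₀ (f≤1 0 z<s)) λ { (s≤s ()) }
    ... | suc zero = inj₂ (0 , cong suc (trans (cong (p *_) (value-zero e λ i i<e →
            small (f≤1 (suc i) (s<s i<e)) (unique z<s (s<s i<e) f₀))) (*-zeroʳ p)))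
      where
      small : ∀ {x} → x ≤ 1 → ¬ x ≡ 1 → x ≤ 0
      small x≤1 x≢1 = ≤-pred (≤∧≢⇒< x≤1 x≢1)
    ... | zero with value≡p^a e (f ∘ suc) (λ i i<e → f≤1 (suc i) (s<s i<e))
                      (λ i<j j<e → unique (s<s i<j) (s<s j<e))
    ...   | inj₁ v≡0       = inj₁ (trans (cong (p *_) v≡0) (*-zeroʳ p))
    ...   | inj₂ (a , v≡p) = inj₂ (suc a , cong (p *_) v≡p)

  module Half {p h : ℕ} (p-prime : Prime p) (p≡1+h+h : p ≡ suc (h + h)) where

    instance
      p-nonZero : NonZero p
      p-nonZero = prime⇒nonZero p-prime

    open Base p {{p-nonZero}} public

    h<p : h < p
    h<p = subst (h <_) (sym p≡1+h+h) (s≤s (m≤m+n h h))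

    0<h : 0 < h
    0<h = n≢0⇒n>0 λ h≡0 → <-irrefl refl (subst (1 <_) (trans p≡1+h+h (cong (λ x → suc (x + x)) h≡0))
      (nonTrivial⇒n>1 p {{prime⇒nonTrivial p-prime}}))

    h+h<p : ∀ {x} → x ≤ h + h → x < p
    h+h<p x≤h+h = subst (_ <_) (sym p≡1+h+h) (s≤s x≤h+h)

    -- The coefficient of x ^ k in ∏_{i < e} (1 + x ^ p ^ i) ^ h.
    coeff : ℕ → ℕ → ℕ
    coeff zero    k = 1
    coeff (suc e) k = (h C (k % p)) * coeff e (k / p)

    module _ {c x : ℕ} (c<p : c < p) where
      open ≡-Reasoning

      [c+px]%p≡c : (c + p * x) % p ≡ c
      [c+px]%p≡c = begin
        (c + p * x) % p ≡⟨ cong (λ y → (c + y) % p) (*-comm p x) ⟩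
        (c + x * p) % p ≡⟨ [m+kn]%n≡m%n c x p ⟩
        c % p           ≡⟨ m<n⇒m%n≡m c<p ⟩
        c               ∎

      [c+px]/p≡x : (c + p * x) / p ≡ x
      [c+px]/p≡x = begin
        (c + p * x) / p   ≡⟨ cong (λ y → (c + y) / p) (*-comm p x) ⟩
        (c + x * p) / p   ≡⟨ +-distrib-/-∣ʳ c (divides-refl x) ⟩
        c / p + x * p / p ≡⟨ cong₂ _+_ (m<n⇒m/n≡0 c<p) (m*n/n≡m x p) ⟩
        x                 ∎

      coeff-suc : ∀ e → coeff (suc e) (c + p * x) ≡ (h C c) * coeff e x
      coeff-suc e = cong₂ (λ u v → (h C u) * coeff e v) [c+px]%p≡c [c+px]/p≡x

    -- Unfolded, the coefficient is the product of the `h C f i`, and `p` divides none of them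
    -- because `f i ≤ h < p`.
    p∤coeff : ∀ e {f} → f ≤ h upTo e → ¬ p ∣ coeff e (value e f)
    p∤coeff zero    f≤h p∣1 = >⇒∤ (nonTrivial⇒n>1 p {{prime⇒nonTrivial p-prime}}) p∣1
    p∤coeff (suc e) {f} f≤h p∣c
      with euclidsLemma (h C f 0) (coeff e (value e (f ∘ suc))) p-prime
             (subst (p ∣_) (coeff-suc (≤-<-trans (f≤h 0 z<s) h<p) e) p∣c)
    ... | inj₁ p∣C = p∤nCk p-prime h<p (f≤h 0 z<s) p∣C
    ... | inj₂ p∣c = p∤coeff e (λ i i<e → f≤h (suc i) (s<s i<e)) p∣c

    -- A digit above `h` makes its factor `h C f i` zero. The bound `f i < p` ensures that `coeff`
    -- reads off the entries of `f`.
    p∤coeff⇒≤h : ∀ e {f} → (∀ i → i < e → f i < p) → ¬ p ∣ coeff e (value e f) → f ≤ h upTo e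
    p∤coeff⇒≤h (suc e) {f} f<p p∤c zero _ = ≮⇒≥ λ h<f₀ → p∤c (subst (p ∣_) (sym
      (trans (coeff-suc (f<p 0 z<s) e) (cong (_* coeff e (value e (f ∘ suc))) (k>n⇒nCk≡0 h<f₀)))) (p ∣0))
    p∤coeff⇒≤h (suc e) {f} f<p p∤c (suc i) (s<s i<e) =
      p∤coeff⇒≤h e (λ j j<e → f<p (suc j) (s<s j<e))
        (λ p∣c → p∤c (subst (p ∣_) (sym (coeff-suc (f<p 0 z<s) e)) (∣n⇒∣m*n (h C f 0) p∣c))) i i<e

    2*value< : ∀ e {f} → f ≤ h upTo e → value e f + value e f < p ^ e
    2*value< e {f} f≤h = subst (_< p ^ e) (value-+ e f f)
      (value-< e (λ i i<e → h+h<p (+-mono-≤ (f≤h i i<e) (f≤h i i<e))))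

    -- Multipliers preserving the numbers with all digits at most `h`.

    module _ {d n t : ℕ} (0<d : 0 < d) (p^d≡1+n : p ^ d ≡ suc n) (t<p^d : t < p ^ d)
             (t-cancel : ∀ {l} → n ∣ t * l → n ∣ l)
             (closed : ∀ {l r} y → 0 < l → l < n → ¬ p ∣ coeff d l →
                       0 < r → r < n → t * l ≡ r + y * n → ¬ p ∣ coeff d r) where

      private
        f : ℕ → ℕ
        f = digit t

        t≡ : value d f ≡ t
        t≡ = value-digit d t<p^d

        instance
          d-nonZero : NonZero d
          d-nonZero = >-nonZero 0<d

      -- `closed` speaks of `l` and `r` strictly between 0 and `n`. Doubling gives `l < n`, and
      -- `r = 0` or `r = n` would make `n` divide `t * l`, hence `l`. The entries of `g` are at most
      -- `p - 1`, so they are the digits of `r` and the coefficient criterion applies to them.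
      closed-digits : ∀ {g u} y → u ≤ h upTo d → 0 < value d u → g ≤ h + h upTo d →
                      t * value d u ≡ value d g + y * n → g ≤ h upTo d
      closed-digits {g} {u} y u≤h 0<l g≤2h tl≡ = p∤coeff⇒≤h d g<p
        (closed y 0<l l<n (p∤coeff d u≤h) (n≢0⇒n>0 r≢0) (≤∧≢⇒< r≤n r≢n) tl≡)
        where
        l = value d u
        r = value d g
        g<p : ∀ i → i < d → g i < p
        g<p i i<d = h+h<p (g≤2h i i<d)
        2l≤n : l + l ≤ n
        2l≤n = ≤-pred (subst (l + l <_) p^d≡1+n (2*value< d u≤h))
        l<n : l < n
        l<n = <-≤-trans (m<m+n l 0<l) 2l≤n
        n∤tl : ¬ n ∣ t * l
        n∤tl n∣tl = >⇒∤ {{>-nonZero 0<l}} l<n (t-cancel n∣tl)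
        r≤n : r ≤ n
        r≤n = ≤-pred (subst (r <_) p^d≡1+n (value-< d g<p))
        r≢0 : r ≢ 0
        r≢0 r≡0 = n∤tl (divides y (trans tl≡ (cong (_+ y * n) r≡0)))
        r≢n : r ≢ n
        r≢n r≡n = n∤tl (divides (suc y) (trans tl≡ (cong (_+ y * n) r≡n)))

      multiple-≤h : ∀ l .{{_ : NonZero l}} → l ≤ h → (λ i → l * f i) ≤ h + h upTo d →
                    (λ i → l * f i) ≤ h upTo d
      multiple-≤h l l≤h = λ lf≤2h → closed-digits 0
        (λ i i<d → ≤-trans (single-≤ l d i i<d) l≤h)
        (subst (0 <_) (sym (value-single d l)) (>-nonZero⁻¹ l)) lf≤2h
        (begin
          t * value d (single l)      ≡⟨ cong (t *_) (value-single d l) ⟩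
          t * l                       ≡⟨ *-comm t l ⟩
          l * t                       ≡⟨ cong (l *_) t≡ ⟨
          l * value d f               ≡⟨ value-* d l f ⟨
          value d (λ i → l * f i)     ≡⟨ +-identityʳ _ ⟨
          value d (λ i → l * f i) + 0 * n ∎)
        where open ≡-Reasoning

      -- Multiplying t by l = 1, …, h never carries: l f i ≤ h gives (l + 1) f i ≤ h + h < p.
      multiples-≤h : ∀ l → l < h → (λ i → suc l * f i) ≤ h upTo d
      multiples-≤h zero    0<h = multiple-≤h 1 0<h λ i _ →
        ≤-trans (≤-reflexive (*-identityˡ (f i))) (≤-pred (subst (f i <_) p≡1+h+h (digit<p t i)))
      multiples-≤h (suc l) l<h = multiple-≤h (suc (suc l)) l<h λ i i<d → +-mono-≤
        (≤-trans (m≤n*m (f i) (suc l)) (multiples-≤h l (<⇒≤ l<h) i i<d))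
        (multiples-≤h l (<⇒≤ l<h) i i<d)

      -- The multiple by `h` itself gives `h * f i ≤ h`, and `h` cancels.
      digits-≤1 : f ≤ 1 upTo d
      digits-≤1 i i<d = *-cancelˡ-≤ h (subst₂ (λ m b → m * f i ≤ b) (suc-pred h) (sym (*-identityʳ h))
        (multiples-≤h (pred h) (≤-reflexive (suc-pred h)) i i<d))
        where instance _ = >-nonZero 0<h

      -- For digits 1 at positions i < j, multiplying by h + h p ^ (j - i) makes them
      -- collide into the digit h + h.
      digits-unique : ∀ {i j} → i < j → j < d → f i ≡ 1 → ¬ f j ≡ 1
      digits-unique {i} {j} i<j j<d fᵢ≡1 fⱼ≡1 =
        <⇒≱ (m<m+n h 0<h) (subst (_≤ h) gⱼ≡h+h (g≤h j j<d))
        where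
        k = j ∸ i
        e = d ∸ k
        0<k : 0 < k
        0<k = m<n⇒0<n∸m i<j
        k<d : k < d
        k<d = ≤-<-trans (m∸n≤m j i) j<d
        0<e : 0 < e
        0<e = m<n⇒0<n∸m k<d
        k+e≡d : k + e ≡ d
        k+e≡d = m+[n∸m]≡n (<⇒≤ k<d)
        k+i≡j : k + i ≡ j
        k+i≡j = m∸n+n≡m (<⇒≤ i<j)
        instance
          k-nonZero : NonZero k
          k-nonZero = >-nonZero 0<k
          e-nonZero : NonZero e
          e-nonZero = >-nonZero 0<e

        u g : ℕ → ℕ
        -- The digit `h` at places 0 and `k`. The product of this number with `t` has the entries
        -- `g` modulo `n`, since `p ^ k` acts by rotation.
        u = splice k (single h) (single h)
        g m = h * f m + h * rotate k e f m

        rotate-≤1 : rotate k e f ≤ 1 upTo d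
        rotate-≤1 = subst (rotate k e f ≤ 1 upTo_) k+e≡d
          (rotate-≤ k e (subst (f ≤ 1 upTo_) (sym k+e≡d) digits-≤1))

        value-u : value d u ≡ h + p ^ k * h
        value-u = begin
          value d u                                   ≡⟨ cong (λ m → value m u) k+e≡d ⟨
          value (k + e) u                             ≡⟨ value-splice k e (single h) (single h) ⟩
          value k (single h) + p ^ k * value e (single h) ≡⟨ cong₂ (λ x y → x + p ^ k * y) (value-single k h) (value-single e h) ⟩
          h + p ^ k * h                               ∎
          where open ≡-Reasoning

        y = value k (λ m → f (e + m))
        r = value d (rotate k e f)

        p^k*t : p ^ k * t ≡ r + y * n
        p^k*t = +-cancelʳ-≡ y _ _ (begin
          p ^ k * t + y               ≡⟨ cong (λ v → p ^ k * v + y) t≡ ⟨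
          p ^ k * value d f + y       ≡⟨ cong (λ m → p ^ k * value m f + y) k+e≡d ⟨
          p ^ k * value (k + e) f + y ≡⟨ value-rotate k e f ⟩
          value (k + e) (rotate k e f) + p ^ (k + e) * y ≡⟨ cong (λ m → value m (rotate k e f) + p ^ m * y) k+e≡d ⟩
          r + p ^ d * y               ≡⟨ cong (λ m → r + m * y) p^d≡1+n ⟩
          r + suc n * y               ≡⟨ lemma r n y ⟩
          r + y * n + y               ∎)
          where
          open ≡-Reasoning
          lemma : ∀ r n y → r + suc n * y ≡ r + y * n + y
          lemma = solve-∀

        t*u : t * value d u ≡ value d g + h * y * n
        t*u = begin
          t * value d u             ≡⟨ cong (t *_) value-u ⟩
          t * (h + p ^ k * h)       ≡⟨ lemma₁ t h (p ^ k) ⟩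
          h * t + h * (p ^ k * t)   ≡⟨ cong (λ v → h * t + h * v) p^k*t ⟩
          h * t + h * (r + y * n)   ≡⟨ lemma₂ t h r y n ⟩
          h * t + h * r + h * y * n ≡⟨ cong (λ v → h * v + h * r + h * y * n) t≡ ⟨
          h * value d f + h * r + h * y * n ≡⟨ cong₂ (λ a b → a + b + h * y * n) (value-* d h f) (value-* d h (rotate k e f)) ⟨
          value d (λ m → h * f m) + value d (λ m → h * rotate k e f m) + h * y * n
            ≡⟨ cong (_+ h * y * n) (value-+ d (λ m → h * f m) (λ m → h * rotate k e f m)) ⟨
          value d g + h * y * n     ∎
          where
          open ≡-Reasoning
          lemma₁ : ∀ t h x → t * (h + x * h) ≡ h * t + h * (x * t)
          lemma₁ = solve-∀
          lemma₂ : ∀ t h r y n → h * t + h * (r + y * n) ≡ h * t + h * r + h * y * n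
          lemma₂ = solve-∀

        h*≤h : ∀ {x} → x ≤ 1 → h * x ≤ h
        h*≤h x≤1 = ≤-trans (*-monoʳ-≤ h x≤1) (≤-reflexive (*-identityʳ h))

        g≤h : g ≤ h upTo d
        g≤h = closed-digits (h * y)
          (subst (u ≤ h upTo_) k+e≡d (splice-≤ k e (single-≤ h k) (single-≤ h e)))
          (subst (0 <_) (sym value-u) (<-≤-trans 0<h (m≤m+n h _)))
          (λ m m<d → +-mono-≤ (h*≤h (digits-≤1 m m<d)) (h*≤h (rotate-≤1 m m<d)))
          t*u

        -- Rotation carries the digit at place `i` to place `k + i = j`, where it meets `f j`.
        rotateⱼ≡1 : rotate k e f j ≡ 1
        rotateⱼ≡1 = trans (cong (rotate k e f) (sym k+i≡j)) (trans (splice-+ k _ f i) fᵢ≡1)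

        gⱼ≡h+h : g j ≡ h + h
        gⱼ≡h+h = trans (cong₂ (λ a b → h * a + h * b) fⱼ≡1 rotateⱼ≡1) (cong₂ _+_ (*-identityʳ h) (*-identityʳ h))

      multiplier⇒power : 0 < t → ∃[ a ] t ≡ p ^ a
      multiplier⇒power 0<t with value≡p^a d f digits-≤1 digits-unique
      ... | inj₁ v≡0       = contradiction (trans (sym t≡) v≡0) (>⇒≢ 0<t)
      ... | inj₂ (a , v≡p) = a , trans (sym t≡) v≡p

    -- If all digits of k are at most h, so are those of r ≡ p ^ i k, whence 2 r ≤ n
    -- and (n - k) p ^ i has fractional part 1 - r / n ≥ 1/2 over n.
    upper-half : ∀ {d n a k i} .{{_ : NonZero n}} → p ^ d ≡ suc n → a + k ≡ n → 0 < k →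
                 ¬ p ∣ coeff d k → i < d →
                 ∃[ m ] a * p ^ i / n ≡ m × 2 * a * p ^ i / n ≡ suc (2 * m)
    upper-half {d} {n} {a} {k} {i} p^d≡1+n a+k≡n 0<k p∤c i<d = m ,
      trans (cong (_/ n) ap^i≡) ([s+mn]/n≡m (n ∸ r) m (∸-monoʳ-< 0<r r≤n)) ,
      trans (cong (_/ n) 2ap^i≡) ([s+mn]/n≡m (n ∸ (r + r)) (suc (2 * m))
        (∸-monoʳ-< (<-≤-trans 0<r (m≤m+n r r)) r+r≤n))
      where
      f = digit k
      e = d ∸ i
      i+e≡d : i + e ≡ d
      i+e≡d = m+[n∸m]≡n (<⇒≤ i<d)
      k<p^d : k < p ^ d
      k<p^d = subst (k <_) (sym p^d≡1+n) (s≤s (subst (k ≤_) a+k≡n (m≤n+m k a)))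
      k≡ : value d f ≡ k
      k≡ = value-digit d k<p^d
      f≤h : f ≤ h upTo d
      f≤h = p∤coeff⇒≤h d (λ j _ → digit<p k j) (subst (λ v → ¬ p ∣ coeff d v) (sym k≡) p∤c)

      y r x : ℕ
      y = value i (λ j → f (e + j))
      r = value d (rotate i e f)
      x = value e f

      r+r≤n : r + r ≤ n
      r+r≤n = ≤-pred (subst (r + r <_) p^d≡1+n (2*value< d (subst (rotate i e f ≤ h upTo_) i+e≡d
        (rotate-≤ i e (subst (f ≤ h upTo_) (sym i+e≡d) f≤h)))))
      r≤n : r ≤ n
      r≤n = ≤-trans (m≤m+n r r) r+r≤n

      p^i*k : p ^ i * k ≡ r + y * n
      p^i*k = +-cancelʳ-≡ y _ _ (begin
        p ^ i * k + y               ≡⟨ cong (λ v → p ^ i * v + y) k≡ ⟨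
        p ^ i * value d f + y       ≡⟨ cong (λ m → p ^ i * value m f + y) i+e≡d ⟨
        p ^ i * value (i + e) f + y ≡⟨ value-rotate i e f ⟩
        value (i + e) (rotate i e f) + p ^ (i + e) * y ≡⟨ cong (λ m → value m (rotate i e f) + p ^ m * y) i+e≡d ⟩
        r + p ^ d * y               ≡⟨ cong (λ m → r + m * y) p^d≡1+n ⟩
        r + suc n * y               ≡⟨ lemma r n y ⟩
        r + y * n + y               ∎)
        where
        open ≡-Reasoning
        lemma : ∀ r n y → r + suc n * y ≡ r + y * n + y
        lemma = solve-∀

      r≡ : r ≡ y + p ^ i * x
      r≡ = trans (cong (λ m → value m (rotate i e f)) (sym i+e≡d)) (value-splice i e _ f)

      -- If the rotated number vanished, both digit blocks `y` and `x` would be zero, and so would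
      -- `k`.
      0<r : 0 < r
      0<r = n≢0⇒n>0 λ r≡0 → >⇒≢ 0<k (begin
        k                 ≡⟨ k≡ ⟨
        value d f         ≡⟨ cong (λ m → value m f) (trans (sym i+e≡d) (+-comm i e)) ⟩
        value (e + i) f   ≡⟨ value-split e i f ⟩
        x + p ^ e * y     ≡⟨ cong₂ (λ u v → u + p ^ e * v) (x≡0 r≡0) (y≡0 r≡0) ⟩
        p ^ e * 0         ≡⟨ *-zeroʳ (p ^ e) ⟩
        0                 ∎)
        where
        open ≡-Reasoning
        y≡0 : r ≡ 0 → y ≡ 0
        y≡0 r≡0 = m+n≡0⇒m≡0 y (trans (sym r≡) r≡0)
        x≡0 : r ≡ 0 → x ≡ 0
        x≡0 r≡0 = [ (λ p^i≡0 → contradiction p^i≡0 (≢-nonZero⁻¹ (p ^ i) {{m^n≢0 p i}})) , (λ x≡0 → x≡0) ]′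
          (m*n≡0⇒m≡0∨n≡0 (p ^ i) (m+n≡0⇒n≡0 y (trans (sym r≡) r≡0)))

      ap^i+r : a * p ^ i + r + y * n ≡ p ^ i * n
      ap^i+r = begin
        a * p ^ i + r + y * n   ≡⟨ +-assoc (a * p ^ i) r (y * n) ⟩
        a * p ^ i + (r + y * n) ≡⟨ cong (a * p ^ i +_) p^i*k ⟨
        a * p ^ i + p ^ i * k   ≡⟨ cong (_+ p ^ i * k) (*-comm a (p ^ i)) ⟩
        p ^ i * a + p ^ i * k   ≡⟨ *-distribˡ-+ (p ^ i) a k ⟨
        p ^ i * (a + k)         ≡⟨ cong (p ^ i *_) a+k≡n ⟩
        p ^ i * n               ∎
        where open ≡-Reasoning

      y<p^i : y < p ^ i
      y<p^i = *-cancelʳ-< n y (p ^ i) (subst (y * n <_) ap^i+r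
        (m<n+m (y * n) (<-≤-trans 0<r (m≤n+m r (a * p ^ i)))))

      -- Since `a * p ^ i = p ^ i * n - r - y * n` with `0 < r ≤ n`, one more `n` is borrowed to get
      -- the remainder `n - r`, hence `suc y`. The truncated subtraction is exact because
      -- `y < p ^ i`.
      m : ℕ
      m = p ^ i ∸ suc y

      ap^i≡ : a * p ^ i ≡ n ∸ r + m * n
      ap^i≡ = +-cancelʳ-≡ (r + y * n) _ _ (begin
        a * p ^ i + (r + y * n)     ≡⟨ +-assoc (a * p ^ i) r (y * n) ⟨
        a * p ^ i + r + y * n       ≡⟨ ap^i+r ⟩
        p ^ i * n                   ≡⟨ cong (_* n) (m∸n+n≡m y<p^i) ⟨
        (m + suc y) * n             ≡⟨ lemma₁ m y n ⟩
        n + m * n + y * n           ≡⟨ cong (λ v → v + m * n + y * n) (m∸n+n≡m r≤n) ⟨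
        n ∸ r + r + m * n + y * n   ≡⟨ lemma₂ (n ∸ r) r (m * n) (y * n) ⟩
        n ∸ r + m * n + (r + y * n) ∎)
        where
        open ≡-Reasoning
        lemma₁ : ∀ m y n → (m + suc y) * n ≡ n + m * n + y * n
        lemma₁ = solve-∀
        lemma₂ : ∀ a b c d → a + b + c + d ≡ a + c + (b + d)
        lemma₂ = solve-∀

      -- As `r + r ≤ n`, doubling the remainder `n - r` pushes exactly one `n` into the quotient.
      2ap^i≡ : 2 * a * p ^ i ≡ n ∸ (r + r) + suc (2 * m) * n
      2ap^i≡ = +-cancelʳ-≡ (r + r) _ _ (begin
        2 * a * p ^ i + (r + r)                   ≡⟨ cong (_+ (r + r)) (trans (*-assoc 2 a (p ^ i)) (cong (2 *_) ap^i≡)) ⟩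
        2 * (n ∸ r + m * n) + (r + r)             ≡⟨ lemma₁ (n ∸ r) r m n ⟩
        (n ∸ r + r) + (n ∸ r + r) + 2 * m * n     ≡⟨ cong (λ v → v + v + 2 * m * n) (m∸n+n≡m r≤n) ⟩
        n + n + 2 * m * n                         ≡⟨ cong (λ v → v + n + 2 * m * n) (m∸n+n≡m r+r≤n) ⟨
        n ∸ (r + r) + (r + r) + n + 2 * m * n     ≡⟨ lemma₂ (n ∸ (r + r)) (r + r) m n ⟩
        n ∸ (r + r) + suc (2 * m) * n + (r + r)   ∎)
        where
        open ≡-Reasoning
        lemma₁ : ∀ s r m n → 2 * (s + m * n) + (r + r) ≡ (s + r) + (s + r) + 2 * m * n
        lemma₁ = solve-∀
        lemma₂ : ∀ s r m n → s + r + n + 2 * m * n ≡ s + suc (2 * m) * n + r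
        lemma₂ = solve-∀

      [s+mn]/n≡m : ∀ s m → s < n → (s + m * n) / n ≡ m
      [s+mn]/n≡m s m s<n = begin
        (s + m * n) / n   ≡⟨ +-distrib-/-∣ʳ s (divides-refl m) ⟩
        s / n + m * n / n ≡⟨ cong₂ _+_ (m<n⇒m/n≡0 s<n) (m*n/n≡m m n) ⟩
        m                 ∎
        where open ≡-Reasoning

    -- All digits `h` give `(p ^ e - 1) / 2`: the exponent of Euler's criterion, written in base `p`
    -- for the product expansion.
    value-h : ∀ e → suc (value e (λ _ → h) + value e (λ _ → h)) ≡ p ^ e
    value-h zero    = refl
    value-h (suc e) = begin
      suc (h + p * v + (h + p * v)) ≡⟨ lemma₁ h p v ⟩
      suc (h + h) + p * (v + v)     ≡⟨ cong (_+ p * (v + v)) p≡1+h+h ⟨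
      p + p * (v + v)               ≡⟨ *-suc p (v + v) ⟨
      p * suc (v + v)               ≡⟨ cong (p *_) (value-h e) ⟩
      p * p ^ e                     ∎
      where
      open ≡-Reasoning
      v = value e (λ _ → h)
      lemma₁ : ∀ h p v → suc (h + p * v + (h + p * v)) ≡ suc (h + h) + p * (v + v)
      lemma₁ = solve-∀

open Digits

-- Finite sums and binomial expansions in commutative rings, then characteristic `p`.

module RingSums {c ℓ} (R : CommutativeRing c ℓ) where
  open CommutativeRing R hiding (zero) renaming (_+_ to _+ᶠ_; _*_ to _*ᶠ_)
  open Exp semiring public renaming (_^_ to _^ᶠ_)
  open CommutativeExp commutativeSemiring public using (^-distrib-*)
  open Mult semiring public renaming (_×_ to _·_)
  open Sum semiring public
  open RingProperties ring public using (x∙y⁻¹≈ε⇒x≈y; -‿distribˡ-*; +-cancelˡ; +-cancelʳ)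
  open CommutativeSemigroupProperties *-commutativeSemigroup public using ()
    renaming (x∙yz≈y∙xz to x*yz≈y*xz)
  open ≈-Reasoning setoid

  1^n≈1 : ∀ n → 1# ^ᶠ n ≈ 1#
  1^n≈1 zero    = refl
  1^n≈1 (suc n) = trans (*-identityˡ _) (1^n≈1 n)

  -- Summands live on ℕ so that ranges can be split, padded and regrouped without coercions between
  -- `Fin` types.
  Σ< : ℕ → (ℕ → Carrier) → Carrier
  Σ< N f = sum {N} (f ∘ toℕ)

  Σ<-cong : ∀ N {f g} → (∀ i → i < N → f i ≈ g i) → Σ< N f ≈ Σ< N g
  Σ<-cong N f≈g = sum-cong-≋ (λ i → f≈g (toℕ i) (Fin.toℕ<n i))

  Σ<-zero : ∀ N {f} → (∀ i → i < N → f i ≈ 0#) → Σ< N f ≈ 0#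
  Σ<-zero N f≈0 = trans (Σ<-cong N f≈0) (sum-replicate-zero N)

  Σ<-+ : ∀ M N f → Σ< (M + N) f ≈ Σ< M f +ᶠ Σ< N (λ i → f (M + i))
  Σ<-+ zero    N f = sym (+-identityˡ _)
  Σ<-+ (suc M) N f = trans (+-congˡ (Σ<-+ M N (f ∘ suc))) (sym (+-assoc _ _ _))

  -- Every index below `M * N` is `i + M * j` exactly once; for `M = p` this separates the lowest
  -- digit from the others.
  Σ<-* : ∀ M N f → Σ< (M * N) f ≈ Σ< N (λ j → Σ< M (λ i → f (i + M * j)))
  Σ<-* M zero    f rewrite ℕ.*-zeroʳ M = refl
  Σ<-* M (suc N) f rewrite ℕ.*-suc M N = begin
    Σ< (M + M * N) f                              ≈⟨ Σ<-+ M (M * N) f ⟩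
    Σ< M f +ᶠ Σ< (M * N) (λ i → f (M + i))        ≈⟨ +-cong
      (Σ<-cong M λ i _ → reflexive (≡.cong f (≡.sym (≡.trans (≡.cong (i +_) (ℕ.*-zeroʳ M)) (ℕ.+-identityʳ i)))))
      (Σ<-* M N (λ i → f (M + i))) ⟩
    Σ< M (λ i → f (i + M * 0)) +ᶠ Σ< N (λ j → Σ< M (λ i → f (M + (i + M * j))))
      ≈⟨ +-congˡ (Σ<-cong N λ j _ → Σ<-cong M λ i _ → reflexive (≡.cong f (lemma i j))) ⟩
    Σ< M (λ i → f (i + M * 0)) +ᶠ Σ< N (λ j → Σ< M (λ i → f (i + M * suc j))) ∎
    where
    lemma : ∀ i j → M + (i + M * j) ≡ i + M * suc j
    lemma i j = ≡.trans (≡.sym (ℕ.+-assoc M i (M * j))) (≡.trans (≡.cong (_+ M * j) (ℕ.+-comm M i))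
      (≡.trans (ℕ.+-assoc i M (M * j)) (≡.cong (i +_) (≡.sym (ℕ.*-suc M j)))))

  Σ<-last : ∀ N f → Σ< (suc N) f ≈ Σ< N f +ᶠ f N
  Σ<-last N f = begin
    Σ< (suc N) f                    ≡⟨ ≡.cong (λ M → Σ< M f) (ℕ.+-comm N 1) ⟨
    Σ< (N + 1) f                    ≈⟨ Σ<-+ N 1 f ⟩
    Σ< N f +ᶠ (f (N + 0) +ᶠ 0#)     ≈⟨ +-congˡ (+-identityʳ _) ⟩
    Σ< N f +ᶠ f (N + 0)             ≡⟨ ≡.cong (λ M → Σ< N f +ᶠ f M) (ℕ.+-identityʳ N) ⟩
    Σ< N f +ᶠ f N                   ∎

  Σ<-single : ∀ {N k} f → k < N → (∀ i → i < N → ¬ i ≡ k → f i ≈ 0#) → Σ< N f ≈ f k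
  Σ<-single {suc N} {zero} f _ f≈0 =
    trans (+-congˡ (Σ<-zero N (λ i i<N → f≈0 (suc i) (s<s i<N) λ ()))) (+-identityʳ _)
  Σ<-single {suc N} {suc k} f (s<s k<N) f≈0 =
    trans (+-congʳ (f≈0 0 z<s λ ())) (trans (+-identityˡ _)
      (Σ<-single (f ∘ suc) k<N (λ i i<N i≢k → f≈0 (suc i) (s<s i<N) (i≢k ∘ ℕ.suc-injective))))

  Σ<-*-Σ< : ∀ M N f g → Σ< M f *ᶠ Σ< N g ≈ Σ< N (λ j → Σ< M (λ i → f i *ᶠ g j))
  Σ<-*-Σ< M N f g = trans (*-distribˡ-sum {N} (Σ< M f) (g ∘ toℕ))
    (Σ<-cong N (λ j _ → *-distribʳ-sum {M} (g j) (f ∘ toℕ)))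

  binomial-theorem : ∀ n x → (x +ᶠ 1#) ^ᶠ n ≈ Σ< (suc n) (λ k → (n C k) · (x ^ᶠ k))
  binomial-theorem n x = trans (Binomial.theorem commutativeSemiring n x 1#)
    (Σ<-cong (suc n) {f = λ k → (n C k) · (x ^ᶠ k *ᶠ 1# ^ᶠ (n ∸ k))} λ k _ → ×-congʳ (n C k)
      (trans (*-congˡ (1^n≈1 (n ∸ k))) (*-identityʳ _)))

  ·-*-interchange : ∀ m n x y → (m · x) *ᶠ (n · y) ≈ (m * n) · (x *ᶠ y)
  ·-*-interchange m n x y = begin
    (m · x) *ᶠ (n · y)  ≈⟨ ×-assoc-* m x (n · y) ⟩
    m · (x *ᶠ (n · y))  ≈⟨ ×-congʳ m (×-comm-* n x y) ⟩
    m · (n · (x *ᶠ y))  ≈⟨ ×-assocˡ (x *ᶠ y) m n ⟩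
    (m * n) · (x *ᶠ y)  ∎

  ·≈·1* : ∀ n x → n · x ≈ (n · 1#) *ᶠ x
  ·≈·1* n x = trans (×-congʳ n (sym (*-identityˡ x))) (sym (×-assoc-* n 1# x))

  ∣⇒·≈0 : ∀ {p n} → p · 1# ≈ 0# → p ∣ n → ∀ x → n · x ≈ 0#
  ∣⇒·≈0 {p} p≈0 (divides-refl m) x = begin
    (m * p) · x               ≈⟨ ·≈·1* (m * p) x ⟩
    ((m * p) · 1#) *ᶠ x       ≈⟨ *-congʳ (×1-homo-* m p) ⟩
    ((m · 1#) *ᶠ (p · 1#)) *ᶠ x ≈⟨ *-congʳ (*-congˡ p≈0) ⟩
    ((m · 1#) *ᶠ 0#) *ᶠ x     ≈⟨ *-congʳ (zeroʳ _) ⟩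
    0# *ᶠ x                   ≈⟨ zeroˡ x ⟩
    0#                        ∎

  module Characteristic {p} (p-prime : Prime p) (p≈0 : p · 1# ≈ 0#) where

    frobenius : ∀ x → (x +ᶠ 1#) ^ᶠ p ≈ x ^ᶠ p +ᶠ 1#
    frobenius x = begin
      (x +ᶠ 1#) ^ᶠ p          ≈⟨ binomial-theorem p x ⟩
      Σ< (suc p) term         ≈⟨ Σ<-last p term ⟩
      Σ< p term +ᶠ term p     ≈⟨ +-cong (Σ<-single term 0<p middle) last ⟩
      term 0 +ᶠ x ^ᶠ p        ≈⟨ +-congʳ (×-homo-1 _) ⟩
      1# +ᶠ x ^ᶠ p            ≈⟨ +-comm _ _ ⟩
      x ^ᶠ p +ᶠ 1#            ∎
      where
      term : ℕ → Carrier
      term k = (p C k) · (x ^ᶠ k)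
      0<p : 0 < p
      0<p = ℕ.<-trans z<s (nonTrivial⇒n>1 p {{prime⇒nonTrivial p-prime}})
      middle : ∀ k → k < p → ¬ k ≡ 0 → term k ≈ 0#
      middle k k<p k≢0 = ∣⇒·≈0 p≈0 (p∣pCk p-prime (ℕ.n≢0⇒n>0 k≢0) k<p) (x ^ᶠ k)
      last : term p ≈ x ^ᶠ p
      last = trans (×-congˡ (nCn≡1 p)) (×-homo-1 _)

    module _ {h} (p≡1+h+h : p ≡ suc (h + h)) where
      open Half {p} {h} p-prime p≡1+h+h

      -- (x + 1) ^ ((p ^ e - 1) / 2) = ∏_{i < e} (x ^ p ^ i + 1) ^ h.
      half-power-expansion : ∀ e x → (x +ᶠ 1#) ^ᶠ value e (λ _ → h) ≈
                             Σ< (p ^ e) (λ k → coeff e k · (x ^ᶠ k))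
      half-power-expansion zero    x = sym (trans (+-identityʳ _) (×-homo-1 1#))
      half-power-expansion (suc e) x = begin
        y ^ᶠ (h + p * v)                  ≈⟨ ^-homo-* y h (p * v) ⟩
        y ^ᶠ h *ᶠ y ^ᶠ (p * v)            ≈⟨ *-congˡ (^-assocʳ y p v) ⟨
        y ^ᶠ h *ᶠ (y ^ᶠ p) ^ᶠ v           ≈⟨ *-congˡ (^-congˡ v (frobenius x)) ⟩
        y ^ᶠ h *ᶠ (x ^ᶠ p +ᶠ 1#) ^ᶠ v     ≈⟨ *-cong lower (half-power-expansion e (x ^ᶠ p)) ⟩
        Σ< p f *ᶠ Σ< (p ^ e) g            ≈⟨ Σ<-*-Σ< p (p ^ e) f g ⟩
        -- The index `i + p * j` has lowest digit `i` and remaining digits those of `j`, which is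
        -- how `coeff` recurses.
        Σ< (p ^ e) (λ j → Σ< p (λ i → f i *ᶠ g j)) ≈⟨ Σ<-cong (p ^ e) (λ j _ → Σ<-cong p (λ i → product j)) ⟩
        Σ< (p ^ e) (λ j → Σ< p (λ i → term (i + p * j))) ≈⟨ Σ<-* p (p ^ e) term ⟨
        Σ< (p * p ^ e) term               ∎
        where
        y = x +ᶠ 1#
        v = value e (λ _ → h)
        f g term : ℕ → Carrier
        f i = (h C i) · (x ^ᶠ i)
        g j = coeff e j · ((x ^ᶠ p) ^ᶠ j)
        term k = coeff (suc e) k · (x ^ᶠ k)
        -- The sum up to `h` is padded to length `p = suc h + h` by terms with vanishing binomial
        -- coefficient, so that `i` ranges over all digits.
        lower : y ^ᶠ h ≈ Σ< p f
        lower = begin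
          y ^ᶠ h                                       ≈⟨ binomial-theorem h x ⟩
          Σ< (suc h) f                                 ≈⟨ +-identityʳ _ ⟨
          Σ< (suc h) f +ᶠ 0#                           ≈⟨ +-congˡ (Σ<-zero h λ i _ →
            ×-congˡ {x ^ᶠ (suc h + i)} (k>n⇒nCk≡0 (s≤s (ℕ.m≤m+n h i)))) ⟨
          Σ< (suc h) f +ᶠ Σ< h (λ i → f (suc h + i))   ≈⟨ Σ<-+ (suc h) h f ⟨
          Σ< (suc (h + h)) f                           ≡⟨ ≡.cong (λ N → Σ< N f) p≡1+h+h ⟨
          Σ< p f                                       ∎
        product : ∀ j {i} → i < p → f i *ᶠ g j ≈ term (i + p * j)
        product j {i} i<p = begin
          f i *ᶠ g j                                          ≈⟨ ·-*-interchange (h C i) (coeff e j) _ _ ⟩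
          ((h C i) * coeff e j) · (x ^ᶠ i *ᶠ (x ^ᶠ p) ^ᶠ j)   ≈⟨ ×-congʳ ((h C i) * coeff e j) (*-congˡ (^-assocʳ x p j)) ⟩
          ((h C i) * coeff e j) · (x ^ᶠ i *ᶠ x ^ᶠ (p * j))    ≈⟨ ×-cong (≡.sym (coeff-suc i<p e)) (sym (^-homo-* x i (p * j))) ⟩
          term (i + p * j)                                    ∎

-- Finite fields: cancellation and the characteristic.

module FiniteFields {c ℓ q} (F : FiniteField c ℓ q) where
  open FiniteField F hiding (_^ᶠ_)
  open RingSums commutativeRing public
  open ≈-Reasoning setoid
  private module E = Inverse enumeration

  xy≈0⇒y≈0 : ∀ {x y} → x ≉ 0# → x *ᶠ y ≈ 0# → y ≈ 0#
  xy≈0⇒y≈0 {x} {y} x≉0 xy≈0 with x⁻¹ , x⁻¹x≈1 , _ ← ≉0⇒invertible x≉0 = begin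
    y                 ≈⟨ *-identityˡ y ⟨
    1# *ᶠ y           ≈⟨ *-congʳ x⁻¹x≈1 ⟨
    (x⁻¹ *ᶠ x) *ᶠ y   ≈⟨ *-assoc x⁻¹ x y ⟩
    x⁻¹ *ᶠ (x *ᶠ y)   ≈⟨ *-congˡ xy≈0 ⟩
    x⁻¹ *ᶠ 0#         ≈⟨ zeroʳ x⁻¹ ⟩
    0#                ∎

  *-cancelˡ-≉0 : ∀ {x y z} → x ≉ 0# → x *ᶠ y ≈ x *ᶠ z → y ≈ z
  *-cancelˡ-≉0 {x} {y} {z} x≉0 xy≈xz with x⁻¹ , x⁻¹x≈1 , _ ← ≉0⇒invertible x≉0 = begin
    y                 ≈⟨ *-identityˡ y ⟨
    1# *ᶠ y           ≈⟨ *-congʳ x⁻¹x≈1 ⟨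
    (x⁻¹ *ᶠ x) *ᶠ y   ≈⟨ *-assoc x⁻¹ x y ⟩
    x⁻¹ *ᶠ (x *ᶠ y)   ≈⟨ *-congˡ xy≈xz ⟩
    x⁻¹ *ᶠ (x *ᶠ z)   ≈⟨ *-assoc x⁻¹ x z ⟨
    (x⁻¹ *ᶠ x) *ᶠ z   ≈⟨ *-congʳ x⁻¹x≈1 ⟩
    1# *ᶠ z           ≈⟨ *-identityˡ z ⟩
    z                 ∎

  -- Rewritten as `(x - 1#) *ᶠ y ≈ 0#`. It serves to evaluate geometric sums and to identify a power
  -- of `α` as -1.
  xy≈y⇒y≈0 : ∀ {x y} → x ≉ 1# → x *ᶠ y ≈ y → y ≈ 0#
  xy≈y⇒y≈0 {x} {y} x≉1 xy≈y = xy≈0⇒y≈0 (x≉1 ∘ x∙y⁻¹≈ε⇒x≈y x 1#) (begin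
    (x - 1#) *ᶠ y           ≈⟨ distribʳ y x (- 1#) ⟩
    x *ᶠ y +ᶠ - 1# *ᶠ y     ≈⟨ +-cong xy≈y (trans (sym (-‿distribˡ-* 1# y)) (-‿cong (*-identityˡ y))) ⟩
    y - y                   ≈⟨ -‿inverseʳ y ⟩
    0#                      ∎)

  ^-≉0 : ∀ {x} n → x ≉ 0# → x ^ᶠ n ≉ 0#
  ^-≉0 zero    x≉0 = 1≉0
  ^-≉0 (suc n) x≉0 = ^-≉0 n x≉0 ∘ xy≈0⇒y≈0 x≉0

  0^n≈0 : ∀ {n} → 0 < n → 0# ^ᶠ n ≈ 0#
  0^n≈0 {suc n} _ = zeroˡ _

  -- Translation by 1 permutes the field, so that the sum of all elements is unchanged by adding q · 1.
  q·1≈0 : q · 1# ≈ 0#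
  q·1≈0 = +-cancelˡ (sum E.from) _ _ (begin
    sum E.from +ᶠ q · 1#                    ≈⟨ +-congˡ (sum-replicate q) ⟨
    sum E.from +ᶠ sum {q} (λ _ → 1#)        ≈⟨ ∑-distrib-+ E.from (λ _ → 1#) ⟨
    sum (λ i → E.from i +ᶠ 1#)              ≈⟨ sum-cong-≋ (λ i → E.strictlyInverseʳ (E.from i +ᶠ 1#)) ⟨
    sum (λ i → E.from (shift i))            ≈⟨ sum-permute E.from permutation ⟨
    sum E.from                              ≈⟨ +-identityʳ _ ⟨
    sum E.from +ᶠ 0#                        ∎)
    where
    shift unshift : Fin q → Fin q
    shift i   = E.to (E.from i +ᶠ 1#)
    unshift i = E.to (E.from i - 1#)
    x+1-1≈x : ∀ x → x +ᶠ 1# - 1# ≈ x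
    x+1-1≈x x = trans (+-assoc x 1# (- 1#)) (trans (+-congˡ (-‿inverseʳ 1#)) (+-identityʳ x))
    x-1+1≈x : ∀ x → x - 1# +ᶠ 1# ≈ x
    x-1+1≈x x = trans (+-assoc x (- 1#) 1#) (trans (+-congˡ (-‿inverseˡ 1#)) (+-identityʳ x))
    permutation : Permutation.Permutation q q
    permutation = Permutation.permutation shift unshift
      (λ i → ≡.trans (E.to-cong (trans (+-congʳ (E.strictlyInverseʳ _)) (x-1+1≈x (E.from i)))) (E.strictlyInverseˡ i))
      (λ i → ≡.trans (E.to-cong (trans (+-congʳ (E.strictlyInverseʳ _)) (x+1-1≈x (E.from i)))) (E.strictlyInverseˡ i))

  -- Without zero divisors, some factor of the power must vanish. Applied to `q = p ^ d` this gives
  -- characteristic `p`.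
  m^n·1≈0⇒m·1≈0 : ∀ m n → (m ^ n) · 1# ≈ 0# → m · 1# ≈ 0#
  m^n·1≈0⇒m·1≈0 m zero    1≈0 = contradiction (trans (sym (×-homo-1 1#)) 1≈0) 1≉0
  m^n·1≈0⇒m·1≈0 m (suc n) m^n≈0 with (m · 1#) ≈? 0#
  ... | yes m≈0 = m≈0
  ... | no  m≉0 = m^n·1≈0⇒m·1≈0 m n (xy≈0⇒y≈0 m≉0 (trans (sym (×1-homo-* m (m ^ n))) m^n≈0))

  -- Otherwise Bézout would express 1 through multiples of `n` and `p`, both zero in the field. This
  -- brings vanishing coefficients back to divisibility in ℕ.
  ·1≈0⇒∣ : ∀ {p} → Prime p → p · 1# ≈ 0# → ∀ n → n · 1# ≈ 0# → p ∣ n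
  ·1≈0⇒∣ {p} p-prime p≈0 n n≈0 with p ∣? n
  ... | yes p∣n = p∣n
  ... | no  p∤n = contradiction 1≈0 1≉0
    where
    coprime : Coprime n p
    coprime (d∣n , d∣p) with prime⇒irreducible p-prime d∣p
    ... | inj₁ d≡1    = d≡1
    ... | inj₂ ≡.refl = contradiction d∣n p∤n
    1+x≡y⇒1≈0 : ∀ {x y} → n ∣ x ⊎ p ∣ x → n ∣ y ⊎ p ∣ y → 1 + x ≡ y → 1# ≈ 0#
    1+x≡y⇒1≈0 {x} {y} x∣ y∣ 1+x≡y = begin
      1#              ≈⟨ +-identityʳ 1# ⟨
      1# +ᶠ 0#        ≈⟨ +-congˡ (vanish x∣) ⟨
      (1 + x) · 1#    ≡⟨ ≡.cong (_· 1#) 1+x≡y ⟩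
      y · 1#          ≈⟨ vanish y∣ ⟩
      0#              ∎
      where
      vanish : ∀ {x} → n ∣ x ⊎ p ∣ x → x · 1# ≈ 0#
      vanish (inj₁ n∣x) = ∣⇒·≈0 n≈0 n∣x 1#
      vanish (inj₂ p∣x) = ∣⇒·≈0 p≈0 p∣x 1#
    1≈0 : 1# ≈ 0#
    1≈0 with coprime-Bézout coprime
    ... | Bézout.+- x y eq = 1+x≡y⇒1≈0 (inj₂ (n∣m*n y)) (inj₁ (n∣m*n x)) eq
    ... | Bézout.-+ x y eq = 1+x≡y⇒1≈0 (inj₁ (n∣m*n x)) (inj₂ (n∣m*n y)) eq

  -- Powers of a primitive element, character sums and Euler's criterion.

  module PrimitiveElement {α n} (α-primitive : Primitive α) (q≡1+n : q ≡ suc n) .{{_ : NonZero n}} where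

    α≉0 : α ≉ 0#
    α≉0 = proj₁ α-primitive

    α^i≉0 : ∀ i → α ^ᶠ i ≉ 0#
    α^i≉0 i = ^-≉0 i α≉0

    dlog : ∀ {x} → x ≉ 0# → ∃[ i ] α ^ᶠ i ≈ x
    dlog {x} = proj₂ α-primitive x

    α^e≈1⇒α^[i%e]≈α^i : ∀ e .{{_ : NonZero e}} → α ^ᶠ e ≈ 1# → ∀ i → α ^ᶠ (i % e) ≈ α ^ᶠ i
    α^e≈1⇒α^[i%e]≈α^i e α^e≈1 i = begin
      α ^ᶠ (i % e)                                ≈⟨ *-identityʳ _ ⟨
      α ^ᶠ (i % e) *ᶠ 1#                          ≈⟨ *-congˡ (1^n≈1 (i / e)) ⟨
      α ^ᶠ (i % e) *ᶠ 1# ^ᶠ (i / e)               ≈⟨ *-congˡ (^-congˡ (i / e) α^e≈1) ⟨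
      α ^ᶠ (i % e) *ᶠ (α ^ᶠ e) ^ᶠ (i / e)         ≈⟨ *-congˡ (^-assocʳ α e (i / e)) ⟩
      α ^ᶠ (i % e) *ᶠ α ^ᶠ (e * (i / e))          ≈⟨ ^-homo-* α (i % e) (e * (i / e)) ⟨
      α ^ᶠ (i % e + e * (i / e))                  ≡⟨ ≡.cong (λ k → α ^ᶠ (i % e + k)) (ℕ.*-comm e (i / e)) ⟩
      α ^ᶠ (i % e + i / e * e)                    ≡⟨ ≡.cong (α ^ᶠ_) (m≡m%n+[m/n]*n i e) ⟨
      α ^ᶠ i                                      ∎

    -- If `α ^ᶠ e ≈ 1#`, a nonzero element is determined by its logarithm modulo `e`. With one extra
    -- slot for zero, the field of `suc n` elements injects into `suc e` slots.
    α^e≈1⇒n≤e : ∀ {e} → 0 < e → α ^ᶠ e ≈ 1# → n ≤ e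
    α^e≈1⇒n≤e {e} 0<e α^e≈1 = ℕ.≤-pred (≡.subst (_≤ suc e) q≡1+n (Fin.injective⇒≤ {f = index ∘ E.from}
      (λ {i} {j} eq → ≡.trans (≡.sym (E.strictlyInverseˡ i))
        (≡.trans (E.to-cong (index-injective (E.from i) (E.from j) eq)) (E.strictlyInverseˡ j)))))
      where
      instance
        e-nonZero : NonZero e
        e-nonZero = >-nonZero 0<e
      index : Carrier → Fin (suc e)
      index x with x ≈? 0#
      ... | yes _   = zero
      ... | no  x≉0 = suc (proj₁ (dlog x≉0) mod e)
      mod≡⇒%≡ : ∀ i j → i mod e ≡ j mod e → i % e ≡ j % e
      mod≡⇒%≡ i j eq = ≡.trans (≡.sym (Fin.toℕ-fromℕ< _)) (≡.trans (≡.cong toℕ eq) (Fin.toℕ-fromℕ< _))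
      index-injective : ∀ x y → index x ≡ index y → x ≈ y
      index-injective x y eq with x ≈? 0# | y ≈? 0#
      ... | yes x≈0 | yes y≈0 = trans x≈0 (sym y≈0)
      ... | no  x≉0 | no  y≉0 with i , α^i≈x ← dlog x≉0 | j , α^j≈y ← dlog y≉0 = begin
        x             ≈⟨ α^i≈x ⟨
        α ^ᶠ i        ≈⟨ α^e≈1⇒α^[i%e]≈α^i e α^e≈1 i ⟨
        α ^ᶠ (i % e)  ≡⟨ ≡.cong (α ^ᶠ_) (mod≡⇒%≡ i j (Fin.suc-injective eq)) ⟩
        α ^ᶠ (j % e)  ≈⟨ α^e≈1⇒α^[i%e]≈α^i e α^e≈1 j ⟩
        α ^ᶠ j        ≈⟨ α^j≈y ⟩
        y             ∎

    α^[j∸i]≈1 : ∀ {i j} → i ≤ j → α ^ᶠ i ≈ α ^ᶠ j → α ^ᶠ (j ∸ i) ≈ 1#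
    α^[j∸i]≈1 {i} {j} i≤j α^i≈α^j = *-cancelˡ-≉0 (α^i≉0 i) (begin
      α ^ᶠ i *ᶠ α ^ᶠ (j ∸ i)  ≈⟨ ^-homo-* α i (j ∸ i) ⟨
      α ^ᶠ (i + (j ∸ i))      ≡⟨ ≡.cong (α ^ᶠ_) (ℕ.m+[n∸m]≡n i≤j) ⟩
      α ^ᶠ j                  ≈⟨ α^i≈α^j ⟨
      α ^ᶠ i                  ≈⟨ *-identityʳ _ ⟨
      α ^ᶠ i *ᶠ 1#            ∎)

    -- Pigeonhole on 0 and the powers of `α` with exponents 0 to `q - 1`: zero cannot collide with a
    -- power, so two powers do, at distance `e` with `0 < e ≤ n`. The bound `α^e≈1⇒n≤e` then forces
    -- `e = n`.
    α^n≈1 : α ^ᶠ n ≈ 1#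
    α^n≈1 with Fin.pigeonhole (ℕ.n<1+n q) element
      where
      element : Fin (suc q) → Fin q
      element zero    = E.to 0#
      element (suc i) = E.to (α ^ᶠ toℕ i)
    ... | zero  , suc j , _   , eq = contradiction (sym (Inverse⇒injective eq)) (α^i≉0 (toℕ j))
      where
      Inverse⇒injective : ∀ {x y} → E.to x ≡ E.to y → x ≈ y
      Inverse⇒injective {x} {y} eq = trans (sym (E.strictlyInverseʳ x)) (trans (E.from-cong eq) (E.strictlyInverseʳ y))
    ... | suc i , suc j , s<s i<j , eq = ≡.subst (λ e → α ^ᶠ e ≈ 1#) (ℕ.≤-antisym e≤n (α^e≈1⇒n≤e 0<e α^e≈1)) α^e≈1
      where
      e = toℕ j ∸ toℕ i
      0<e : 0 < e
      0<e = ℕ.m<n⇒0<n∸m i<j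
      α^e≈1 : α ^ᶠ e ≈ 1#
      α^e≈1 = α^[j∸i]≈1 (ℕ.<⇒≤ i<j)
        (trans (sym (E.strictlyInverseʳ _)) (trans (E.from-cong eq) (E.strictlyInverseʳ _)))
      e≤n : e ≤ n
      e≤n = ℕ.≤-pred (≡.subst (e <_) q≡1+n (ℕ.≤-<-trans (ℕ.m∸n≤m (toℕ j) (toℕ i)) (Fin.toℕ<n j)))

    α^[i%n]≈α^i : ∀ i → α ^ᶠ (i % n) ≈ α ^ᶠ i
    α^[i%n]≈α^i = α^e≈1⇒α^[i%e]≈α^i n α^n≈1

    α^-injective : ∀ {i j} → i < n → j < n → α ^ᶠ i ≈ α ^ᶠ j → i ≡ j
    α^-injective {i} {j} i<n j<n eq with ℕ.<-cmp i j
    ... | tri≈ _ i≡j _ = i≡j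
    ... | tri< i<j _ _ = contradiction (α^e≈1⇒n≤e (ℕ.m<n⇒0<n∸m i<j) (α^[j∸i]≈1 (ℕ.<⇒≤ i<j) eq))
                           (ℕ.<⇒≱ (ℕ.≤-<-trans (ℕ.m∸n≤m j i) j<n))
    ... | tri> _ _ j<i = contradiction (α^e≈1⇒n≤e (ℕ.m<n⇒0<n∸m j<i) (α^[j∸i]≈1 (ℕ.<⇒≤ j<i) (sym eq)))
                           (ℕ.<⇒≱ (ℕ.≤-<-trans (ℕ.m∸n≤m i j) i<n))

    α^i≈1⇒n∣i : ∀ {i} → α ^ᶠ i ≈ 1# → n ∣ i
    α^i≈1⇒n∣i {i} α^i≈1 = m%n≡0⇒n∣m i n
      (α^-injective (m%n<n i n) (>-nonZero⁻¹ n) (trans (α^[i%n]≈α^i i) α^i≈1))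

    n∣i⇒α^i≈1 : ∀ {i} → n ∣ i → α ^ᶠ i ≈ 1#
    n∣i⇒α^i≈1 {i} n∣i = trans (sym (α^[i%n]≈α^i i)) (reflexive (≡.cong (α ^ᶠ_) (n∣m⇒m%n≡0 i n n∣i)))

    character-sum : ℕ → Carrier
    character-sum k = Σ< n (λ j → α ^ᶠ (j * k))

    -- Multiplication by `α ^ᶠ k` shifts the terms cyclically, so a factor other than 1 fixes the
    -- sum. Adding 1 makes both sides the same sum of `suc n` terms, split off at either end.
    character-sum≈0 : ∀ {k} → ¬ n ∣ k → character-sum k ≈ 0#
    character-sum≈0 {k} n∤k = xy≈y⇒y≈0 (n∤k ∘ α^i≈1⇒n∣i) (+-cancelˡ 1# _ _ (begin
      1# +ᶠ α ^ᶠ k *ᶠ character-sum k               ≈⟨ +-congˡ (*-distribˡ-sum {n} _ _) ⟩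
      1# +ᶠ Σ< n (λ j → α ^ᶠ k *ᶠ α ^ᶠ (j * k))     ≈⟨ +-congˡ (Σ<-cong n λ j _ → ^-homo-* α k (j * k)) ⟨
      Σ< (suc n) (λ j → α ^ᶠ (j * k))               ≈⟨ Σ<-last n (λ j → α ^ᶠ (j * k)) ⟩
      character-sum k +ᶠ α ^ᶠ (n * k)               ≈⟨ +-congˡ (n∣i⇒α^i≈1 (m∣m*n k)) ⟩
      character-sum k +ᶠ 1#                         ≈⟨ +-comm _ _ ⟩
      1# +ᶠ character-sum k                         ∎))

    1+character-sum≈0 : ∀ {k} → n ∣ k → 1# +ᶠ character-sum k ≈ 0#
    1+character-sum≈0 {k} n∣k = begin
      1# +ᶠ character-sum k   ≈⟨ +-congˡ (Σ<-cong n (λ j _ → n∣i⇒α^i≈1 (∣n⇒∣m*n j n∣k))) ⟩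
      1# +ᶠ Σ< n (λ _ → 1#)   ≈⟨ +-congˡ (sum-replicate n) ⟩
      suc n · 1#              ≡⟨ ≡.cong (_· 1#) q≡1+n ⟨
      q · 1#                  ≈⟨ q·1≈0 ⟩
      0#                      ∎

    module EvenOrder {m} (n≡m+m : n ≡ m + m) where

      0<m : 0 < m
      0<m = ℕ.n≢0⇒n>0 λ m≡0 → ≢-nonZero⁻¹ n (≡.trans n≡m+m (≡.cong (λ k → k + k) m≡0))

      m<n : m < n
      m<n = ≡.subst (m <_) (≡.sym n≡m+m) (ℕ.m<m+n m 0<m)

      α^m*α^m≈1 : α ^ᶠ m *ᶠ α ^ᶠ m ≈ 1#
      α^m*α^m≈1 = trans (sym (^-homo-* α m m)) (trans (^-congʳ α (≡.sym n≡m+m)) α^n≈1)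

      -- `α ^ᶠ m` is a square root of 1 other than 1, so it fixes `α ^ᶠ m +ᶠ 1#`.
      α^m+1≈0 : α ^ᶠ m +ᶠ 1# ≈ 0#
      α^m+1≈0 = xy≈y⇒y≈0 (λ α^m≈1 → ℕ.<⇒≱ m<n (α^e≈1⇒n≤e 0<m α^m≈1)) (begin
        α ^ᶠ m *ᶠ (α ^ᶠ m +ᶠ 1#)              ≈⟨ distribˡ _ _ _ ⟩
        α ^ᶠ m *ᶠ α ^ᶠ m +ᶠ α ^ᶠ m *ᶠ 1#      ≈⟨ +-cong α^m*α^m≈1 (*-identityʳ _) ⟩
        1# +ᶠ α ^ᶠ m                          ≈⟨ +-comm _ _ ⟩
        α ^ᶠ m +ᶠ 1#                          ∎)

      x≉0⇒x^n≈1 : ∀ {x} → x ≉ 0# → x ^ᶠ n ≈ 1#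
      x≉0⇒x^n≈1 {x} x≉0 with i , α^i≈x ← dlog x≉0 = begin
        x ^ᶠ n          ≈⟨ ^-congˡ n α^i≈x ⟨
        (α ^ᶠ i) ^ᶠ n   ≈⟨ ^-assocʳ α i n ⟩
        α ^ᶠ (i * n)    ≈⟨ n∣i⇒α^i≈1 (n∣m*n i) ⟩
        1#              ∎

      square⇒x^m≈1 : ∀ {x} → NonzeroSquare x → x ^ᶠ m ≈ 1#
      square⇒x^m≈1 {x} (x≉0 , y , yy≈x) = begin
        x ^ᶠ m              ≈⟨ ^-congˡ m yy≈x ⟨
        (y *ᶠ y) ^ᶠ m       ≈⟨ ^-distrib-* y y m ⟩
        y ^ᶠ m *ᶠ y ^ᶠ m    ≈⟨ ^-homo-* y m m ⟨
        y ^ᶠ (m + m)        ≡⟨ ≡.cong (y ^ᶠ_) n≡m+m ⟨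
        y ^ᶠ n              ≈⟨ x≉0⇒x^n≈1 (λ y≈0 → x≉0 (trans (sym yy≈x) (trans (*-congʳ y≈0) (zeroˡ y)))) ⟩
        1#                  ∎

      -- The nonsquare half of Euler's criterion. An even logarithm would supply a square root; for
      -- an odd one, `x ^ᶠ m` equals `α ^ᶠ m`, that is -1.
      nonsquare⇒x^m+1≈0 : ∀ {x} → x ≉ 0# → ¬ NonzeroSquare x → x ^ᶠ m +ᶠ 1# ≈ 0#
      nonsquare⇒x^m+1≈0 {x} x≉0 nonsquare with dlog x≉0
      ... | i , α^i≈x with i % 2 | m≡m%n+[m/n]*n i 2 | m%n<n i 2
      ...   | zero        | i≡ | _ = contradiction (x≉0 , α ^ᶠ (i / 2) , (begin
        α ^ᶠ (i / 2) *ᶠ α ^ᶠ (i / 2)  ≈⟨ ^-homo-* α (i / 2) (i / 2) ⟨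
        α ^ᶠ (i / 2 + i / 2)          ≡⟨ ≡.cong (λ k → α ^ᶠ (i / 2 + k)) (ℕ.+-identityʳ (i / 2)) ⟨
        α ^ᶠ (2 * (i / 2))            ≡⟨ ≡.cong (α ^ᶠ_) (≡.trans (ℕ.*-comm 2 (i / 2)) (≡.sym i≡)) ⟩
        α ^ᶠ i                        ≈⟨ α^i≈x ⟩
        x                             ∎)) nonsquare
      ...   | suc zero    | i≡ | _ = trans (+-congʳ (begin
        x ^ᶠ m                        ≈⟨ ^-congˡ m α^i≈x ⟨
        (α ^ᶠ i) ^ᶠ m                 ≈⟨ ^-assocʳ α i m ⟩
        α ^ᶠ (i * m)                  ≡⟨ ≡.cong (λ k → α ^ᶠ (k * m)) i≡ ⟩
        α ^ᶠ (m + i / 2 * 2 * m)      ≈⟨ ^-homo-* α m (i / 2 * 2 * m) ⟩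
        α ^ᶠ m *ᶠ α ^ᶠ (i / 2 * 2 * m) ≈⟨ *-congˡ (n∣i⇒α^i≈1 (divides (i / 2) (lemma (i / 2)))) ⟩
        α ^ᶠ m *ᶠ 1#                  ≈⟨ *-identityʳ _ ⟩
        α ^ᶠ m                        ∎)) α^m+1≈0
        where
        lemma : ∀ k → k * 2 * m ≡ k * n
        lemma k = ≡.trans (ℕ.*-assoc k 2 m) (≡.cong (k *_)
          (≡.trans (≡.cong (m +_) (ℕ.+-identityʳ m)) (≡.sym n≡m+m)))
      ...   | suc (suc _) | _  | s≤s (s≤s ())

-- Arithmetic of canonical residues modulo `n`.

module ResidueProperties (n : ℕ) .{{_ : NonZero n}} where
  open Residues n
  open ≡.≡-Reasoning

  toℕ-mod : ∀ a → toℕ (a mod n) ≡ a % n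
  toℕ-mod a = Fin.toℕ-fromℕ< (m%n<n a n)

  toℕ%n : ∀ (i : Fin n) → toℕ i % n ≡ toℕ i
  toℕ%n i = m<n⇒m%n≡m (Fin.toℕ<n i)

  mod-cong : ∀ {a b} → a % n ≡ b % n → a mod n ≡ b mod n
  mod-cong {a} {b} eq = Fin.toℕ-injective (≡.trans (toℕ-mod a) (≡.trans eq (≡.sym (toℕ-mod b))))

  toℕ-mod-cancel : ∀ (i : Fin n) → toℕ i mod n ≡ i
  toℕ-mod-cancel i = Fin.toℕ-injective (≡.trans (toℕ-mod (toℕ i)) (toℕ%n i))

  mod-⊕ : ∀ a b → a mod n ⊕ b mod n ≡ (a + b) mod n
  mod-⊕ a b = mod-cong (begin
    (toℕ (a mod n) + toℕ (b mod n)) % n ≡⟨ ≡.cong₂ (λ x y → (x + y) % n) (toℕ-mod a) (toℕ-mod b) ⟩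
    (a % n + b % n) % n                 ≡⟨ %-distribˡ-+ a b n ⟨
    (a + b) % n                         ∎)

  mod-⊗ : ∀ a b → (a mod n) ⊗ (b mod n) ≡ (a * b) mod n
  mod-⊗ a b = mod-cong (begin
    (toℕ (a mod n) * toℕ (b mod n)) % n ≡⟨ ≡.cong₂ (λ x y → (x * y) % n) (toℕ-mod a) (toℕ-mod b) ⟩
    (a % n * (b % n)) % n               ≡⟨ %-distribˡ-* a b n ⟨
    (a * b) % n                         ∎)

  ⊗-comm : ∀ i j → i ⊗ j ≡ j ⊗ i
  ⊗-comm i j = ≡.cong (_mod n) (ℕ.*-comm (toℕ i) (toℕ j))

  ⊗-assoc : ∀ i j k → (i ⊗ j) ⊗ k ≡ i ⊗ (j ⊗ k)
  ⊗-assoc i j k = begin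
    (i ⊗ j) ⊗ k                     ≡⟨ ≡.cong ((i ⊗ j) ⊗_) (toℕ-mod-cancel k) ⟨
    (i ⊗ j) ⊗ (toℕ k mod n)         ≡⟨ mod-⊗ (toℕ i * toℕ j) (toℕ k) ⟩
    (toℕ i * toℕ j * toℕ k) mod n   ≡⟨ ≡.cong (_mod n) (ℕ.*-assoc (toℕ i) (toℕ j) (toℕ k)) ⟩
    (toℕ i * (toℕ j * toℕ k)) mod n ≡⟨ mod-⊗ (toℕ i) (toℕ j * toℕ k) ⟨
    (toℕ i mod n) ⊗ (j ⊗ k)         ≡⟨ ≡.cong (_⊗ (j ⊗ k)) (toℕ-mod-cancel i) ⟩
    i ⊗ (j ⊗ k)                     ∎

  ⊗-identityˡ : ∀ i → 𝟙 ⊗ i ≡ i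
  ⊗-identityˡ i = begin
    𝟙 ⊗ i                   ≡⟨ ≡.cong (𝟙 ⊗_) (toℕ-mod-cancel i) ⟨
    𝟙 ⊗ (toℕ i mod n)       ≡⟨ mod-⊗ 1 (toℕ i) ⟩
    (1 * toℕ i) mod n       ≡⟨ ≡.cong (_mod n) (ℕ.*-identityˡ (toℕ i)) ⟩
    toℕ i mod n             ≡⟨ toℕ-mod-cancel i ⟩
    i                       ∎

  ⊗-identityʳ : ∀ i → i ⊗ 𝟙 ≡ i
  ⊗-identityʳ i = ≡.trans (⊗-comm i 𝟙) (⊗-identityˡ i)

  -- Relates the inverses of `j` and `t ⊗ j`, the residues at which membership of `j` and `t ⊗ j` in
  -- `S₀` tests the defect.
  inverse-of-⊗ : ∀ {t j v w} → t ⊗ j ⊗ v ≡ 𝟙 → w ⊗ j ≡ 𝟙 → w ≡ t ⊗ v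
  inverse-of-⊗ {t} {j} {v} {w} tjv≡𝟙 wj≡𝟙 = begin
    w                   ≡⟨ ⊗-identityʳ w ⟨
    w ⊗ 𝟙               ≡⟨ ≡.cong (w ⊗_) tjv≡𝟙 ⟨
    w ⊗ (t ⊗ j ⊗ v)     ≡⟨ ≡.cong (λ x → w ⊗ (x ⊗ v)) (⊗-comm t j) ⟩
    w ⊗ (j ⊗ t ⊗ v)     ≡⟨ ≡.cong (w ⊗_) (⊗-assoc j t v) ⟩
    w ⊗ (j ⊗ (t ⊗ v))   ≡⟨ ⊗-assoc w j (t ⊗ v) ⟨
    w ⊗ j ⊗ (t ⊗ v)     ≡⟨ ≡.cong (_⊗ (t ⊗ v)) wj≡𝟙 ⟩
    𝟙 ⊗ (t ⊗ v)         ≡⟨ ⊗-identityˡ (t ⊗ v) ⟩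
    t ⊗ v               ∎

  fixes-unit⇒𝟙 : ∀ {t j w} → j ⊗ w ≡ 𝟙 → j ≡ t ⊗ j → t ≡ 𝟙
  fixes-unit⇒𝟙 {t} {j} {w} jw≡𝟙 j≡tj = begin
    t             ≡⟨ ⊗-identityʳ t ⟨
    t ⊗ 𝟙         ≡⟨ ≡.cong (t ⊗_) jw≡𝟙 ⟨
    t ⊗ (j ⊗ w)   ≡⟨ ⊗-assoc t j w ⟨
    t ⊗ j ⊗ w     ≡⟨ ≡.cong (_⊗ w) j≡tj ⟨
    j ⊗ w         ≡⟨ jw≡𝟙 ⟩
    𝟙             ∎

  -- n ∸ toℕ i may equal n, hence the further reduction.
  ⊖_ : Fin n → Fin n
  ⊖ i = (n ∸ toℕ i) mod n

  i⊕j⊕⊖j≡i : ∀ i j → i ⊕ j ⊕ ⊖ j ≡ i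
  i⊕j⊕⊖j≡i i j = begin
    i ⊕ j ⊕ ⊖ j                           ≡⟨ mod-⊕ (toℕ i + toℕ j) (n ∸ toℕ j) ⟩
    (toℕ i + toℕ j + (n ∸ toℕ j)) mod n   ≡⟨ ≡.cong (_mod n) (≡.trans (ℕ.+-assoc (toℕ i) (toℕ j) (n ∸ toℕ j))
                                               (≡.cong (toℕ i +_) (ℕ.m+[n∸m]≡n (ℕ.<⇒≤ (Fin.toℕ<n j))))) ⟩
    (toℕ i + n) mod n                     ≡⟨ mod-cong ([m+n]%n≡m%n (toℕ i) n) ⟩
    toℕ i mod n                           ≡⟨ toℕ-mod-cancel i ⟩
    i                                     ∎

  i⊕⊖j⊕j≡i : ∀ i j → i ⊕ ⊖ j ⊕ j ≡ i
  i⊕⊖j⊕j≡i i j = begin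
    i ⊕ ⊖ j ⊕ j                                   ≡⟨ ≡.cong₂ (λ x y → x ⊕ ⊖ j ⊕ y) (toℕ-mod-cancel i) (toℕ-mod-cancel j) ⟨
    toℕ i mod n ⊕ (n ∸ toℕ j) mod n ⊕ toℕ j mod n ≡⟨ ≡.cong (_⊕ toℕ j mod n) (mod-⊕ (toℕ i) (n ∸ toℕ j)) ⟩
    (toℕ i + (n ∸ toℕ j)) mod n ⊕ toℕ j mod n     ≡⟨ mod-⊕ (toℕ i + (n ∸ toℕ j)) (toℕ j) ⟩
    (toℕ i + (n ∸ toℕ j) + toℕ j) mod n           ≡⟨ ≡.cong (_mod n) (≡.trans (ℕ.+-assoc (toℕ i) (n ∸ toℕ j) (toℕ j))
                                                       (≡.cong (toℕ i +_) (ℕ.m∸n+n≡m (ℕ.<⇒≤ (Fin.toℕ<n j))))) ⟩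
    (toℕ i + n) mod n                             ≡⟨ mod-cong ([m+n]%n≡m%n (toℕ i) n) ⟩
    toℕ i mod n                                   ≡⟨ toℕ-mod-cancel i ⟩
    i                                             ∎

  ^-mod∈⟨⟩ : ∀ b a → (b ^ a) mod n ∈ ⟨ b mod n ⟩
  ^-mod∈⟨⟩ b zero    = identity
  ^-mod∈⟨⟩ b (suc a) = ≡.subst (_∈ ⟨ b mod n ⟩) (mod-⊗ b (b ^ a)) (product generator (^-mod∈⟨⟩ b a))

  power∈⟨⟩ : ∀ {i b} → ∃[ a ] toℕ i ≡ b ^ a → i ∈ ⟨ b mod n ⟩
  power∈⟨⟩ {i} {b} (a , i≡b^a) = ≡.subst (_∈ ⟨ b mod n ⟩)
    (≡.trans (≡.cong (_mod n) (≡.sym i≡b^a)) (toℕ-mod-cancel i)) (^-mod∈⟨⟩ b a)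

  leastPositive≡toℕ : ∀ i → 0 < toℕ i → leastPositive i ≡ toℕ i
  leastPositive≡toℕ i 0<i with toℕ i
  ... | suc _ = ≡.refl

  module _ (1<n : 1 < n) where

    toℕ-inverse : ∀ {i j} → j ⊗ i ≡ 𝟙 → (toℕ j * toℕ i) % n ≡ 1
    toℕ-inverse {i} {j} ji≡𝟙 = begin
      (toℕ j * toℕ i) % n ≡⟨ toℕ-mod (toℕ j * toℕ i) ⟨
      toℕ (j ⊗ i)         ≡⟨ ≡.cong toℕ ji≡𝟙 ⟩
      toℕ 𝟙               ≡⟨ toℕ-mod 1 ⟩
      1 % n               ≡⟨ m<n⇒m%n≡m 1<n ⟩
      1                   ∎

    unit-cancel : ∀ {i j} → j ⊗ i ≡ 𝟙 → ∀ {l} → n ∣ toℕ i * l → n ∣ l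
    unit-cancel {i} {j} ji≡𝟙 {l} n∣il = ∣m+n∣m⇒∣n
      (≡.subst (n ∣_) jil≡ (∣n⇒∣m*n (toℕ j) n∣il)) (divides (q * l) ≡.refl)
      where
      q = toℕ j * toℕ i / n
      lemma : ∀ q l n → q * l * n + l ≡ (1 + q * n) * l
      lemma = solve-∀
      jil≡ : toℕ j * (toℕ i * l) ≡ q * l * n + l
      jil≡ = begin
        toℕ j * (toℕ i * l)                   ≡⟨ ℕ.*-assoc (toℕ j) (toℕ i) l ⟨
        toℕ j * toℕ i * l                     ≡⟨ ≡.cong (_* l) (m≡m%n+[m/n]*n (toℕ j * toℕ i) n) ⟩
        ((toℕ j * toℕ i) % n + q * n) * l     ≡⟨ ≡.cong (λ x → (x + q * n) * l) (toℕ-inverse {i} {j} ji≡𝟙) ⟩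
        (1 + q * n) * l                       ≡⟨ lemma q l n ⟨
        q * l * n + l                         ∎

    unit>0 : ∀ {i j} → j ⊗ i ≡ 𝟙 → 0 < toℕ i
    unit>0 {i} {j} ji≡𝟙 = ℕ.n≢0⇒n>0 λ i≡0 →
      contradiction (unit-cancel {i} {j} ji≡𝟙 {1} (≡.subst (λ x → n ∣ x * 1) (≡.sym i≡0) (n ∣0))) (>⇒∤ 1<n)

-- Parity of `n`, and positive defect as a vanishing coefficient.

module OddPrimePower (p d h : ℕ) (p-prime : Prime p) (p≡1+h+h : p ≡ suc (h + h)) (d>0 : 0 < d) where
  open SLCE p d p-prime d>0
  open ResidueProperties n
  open Half {p} {h} p-prime p≡1+h+h hiding (p-nonZero)

  m : ℕ
  m = value d (λ _ → h)

  n≡m+m : n ≡ m + m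
  n≡m+m = ≡.cong (_∸ 1) (≡.sym (value-h d))

  q≡1+n : q ≡ suc n
  q≡1+n = ≡.trans (≡.sym (value-h d)) (≡.cong suc (≡.sym n≡m+m))

  1<n : 1 < n
  1<n with m | n≡m+m
  ... | zero  | n≡0 = contradiction n≡0 (≢-nonZero⁻¹ n)
  ... | suc k | n≡  = ≡.subst (1 <_) (≡.sym n≡) (s≤s (ℕ.≤-trans (s≤s z≤n) (ℕ.m≤n+m (suc k) k)))

  -- By contraposition: if `p` does not divide the coefficient, `upper-half` makes every summand
  -- `2m + 1 - 2m = 1`, so the sum is `d` and the defect is 0.
  defect>0⇒p∣coeff : ∀ {a l} → a + l ≡ n → 0 < l → defect a ℤ.> ℤ.+ 0 → p ∣ coeff d l
  defect>0⇒p∣coeff {a} {l} a+l≡n 0<l defect>0 with p ∣? coeff d l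
  ... | yes p∣c = p∣c
  ... | no  p∤c = contradiction defect>0 (ℤ.≤⇒≯ (ℤ.≤-reflexive
        (≡.trans (≡.cong (λ x → ℤ.+ d ℤ.- x) (sum-of-ones d summand)) (ℤ.+-inverseʳ (ℤ.+ d)))))
    where
    sum-of-ones : ∀ N {f : Fin N → ℤ.ℤ} → (∀ i → f i ≡ ℤ.+ 1) → ℤSum.sum f ≡ ℤ.+ N
    sum-of-ones zero    f≡1 = ≡.refl
    sum-of-ones (suc N) f≡1 = ≡.cong₂ ℤ._+_ (f≡1 zero) (sum-of-ones N (λ i → f≡1 (suc i)))
    1+2m-2m≡1 : ∀ {x y} → ∃[ m ] x ≡ m × y ≡ suc (2 * m) → ℤ.+ y ℤ.- ℤ.+ 2 ℤ.* ℤ.+ x ≡ ℤ.+ 1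
    1+2m-2m≡1 (m , ≡.refl , ≡.refl) = begin
      ℤ.+ suc (2 * m) ℤ.- ℤ.+ 2 ℤ.* ℤ.+ m               ≡⟨ ≡.cong (λ x → ℤ.+ suc (2 * m) ℤ.- x) (ℤ.pos-* 2 m) ⟨
      ℤ.+ 1 ℤ.+ ℤ.+ (2 * m) ℤ.- ℤ.+ (2 * m)             ≡⟨ ℤ.+-assoc (ℤ.+ 1) (ℤ.+ (2 * m)) (ℤ.- (ℤ.+ (2 * m))) ⟩
      ℤ.+ 1 ℤ.+ (ℤ.+ (2 * m) ℤ.- ℤ.+ (2 * m))           ≡⟨ ≡.cong (λ x → ℤ.+ 1 ℤ.+ x) (ℤ.+-inverseʳ (ℤ.+ (2 * m))) ⟩
      ℤ.+ 1                                             ∎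
      where open ≡.≡-Reasoning
    summand : ∀ i → ℤ.+ (2 * a * p ^ toℕ i / n) ℤ.- ℤ.+ 2 ℤ.* ℤ.+ (a * p ^ toℕ i / n) ≡ ℤ.+ 1
    summand i = 1+2m-2m≡1 (upper-half q≡1+n a+l≡n 0<l p∤c (Fin.toℕ<n i))

-- Fourier coefficients of the SLCE sequence in `F`.

module Spectrum {c ℓ} {p d h : ℕ} (p-prime : Prime p) (p≡1+h+h : p ≡ suc (h + h)) (d>0 : 0 < d)
                (F : FiniteField c ℓ (p ^ d)) {α : FiniteField.Carrier F}
                (α-primitive : FiniteField.Primitive F α) where
  open SLCE p d p-prime d>0
  open ResidueProperties n
  open OddPrimePower p d h p-prime p≡1+h+h d>0
  open Half {p} {h} p-prime p≡1+h+h hiding (p-nonZero)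
  open FiniteField F hiding (_^ᶠ_)
  open FiniteFields F
  open PrimitiveElement α-primitive q≡1+n
  open EvenOrder {m} n≡m+m
  open ≈-Reasoning setoid

  p·1≈0 : p · 1# ≈ 0#
  p·1≈0 = m^n·1≈0⇒m·1≈0 p d q·1≈0

  open Characteristic p-prime p·1≈0

  s : ℕ → ℕ
  s = slceSequence F α

  private
    x : ℕ → Carrier
    x j = α ^ᶠ j +ᶠ 1#

  δ : Carrier → Carrier
  δ x = if does (x ≈? 0#) then 1# else 0#

  -- Euler's criterion covers nonzero squares and nonsquares. At zero the power vanishes because
  -- `0 < m`, and `δ` supplies the 1.
  sequence-identity : ∀ j → j < n → s j · 1# +ᶠ s j · 1# +ᶠ x j ^ᶠ m +ᶠ δ (x j) ≈ 1#
  -- `s j` evaluates at `j % n`, so the identity is proved there and transported to `j`. Abstracting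
  -- over the two decisions in `by-cases` lets the conditionals reduce together.
  sequence-identity j j<n = ≡.subst
    (λ i → s j · 1# +ᶠ s j · 1# +ᶠ x i ^ᶠ m +ᶠ δ (x i) ≈ 1#) (m<n⇒m%n≡m j<n)
    (by-cases (x (j % n)) (x (j % n) ≈? 0#) (nonzeroSquare? (x (j % n))))
    where
    by-cases : ∀ y (zero? : Dec (y ≈ 0#)) (square? : Dec (NonzeroSquare y)) →
               let k = if does (zero? ⊎-dec square?) then 0 else 1 in
               k · 1# +ᶠ k · 1# +ᶠ y ^ᶠ m +ᶠ (if does zero? then 1# else 0#) ≈ 1#
    by-cases y (yes y≈0) square? = begin
      0# +ᶠ 0# +ᶠ y ^ᶠ m +ᶠ 1#  ≈⟨ +-congʳ (trans (+-congʳ (+-identityˡ 0#)) (+-identityˡ _)) ⟩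
      y ^ᶠ m +ᶠ 1#              ≈⟨ +-congʳ (trans (^-congˡ m y≈0) (0^n≈0 0<m)) ⟩
      0# +ᶠ 1#                  ≈⟨ +-identityˡ 1# ⟩
      1#                        ∎
    by-cases y (no y≉0) (yes square) = begin
      0# +ᶠ 0# +ᶠ y ^ᶠ m +ᶠ 0#  ≈⟨ trans (+-identityʳ _) (trans (+-congʳ (+-identityˡ 0#)) (+-identityˡ _)) ⟩
      y ^ᶠ m                    ≈⟨ square⇒x^m≈1 square ⟩
      1#                        ∎
    by-cases y (no y≉0) (no nonsquare) = begin
      1 · 1# +ᶠ 1 · 1# +ᶠ y ^ᶠ m +ᶠ 0#  ≈⟨ +-identityʳ _ ⟩
      1 · 1# +ᶠ 1 · 1# +ᶠ y ^ᶠ m        ≈⟨ +-congʳ (+-cong (×-homo-1 1#) (×-homo-1 1#)) ⟩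
      1# +ᶠ 1# +ᶠ y ^ᶠ m                ≈⟨ +-assoc 1# 1# _ ⟩
      1# +ᶠ (1# +ᶠ y ^ᶠ m)              ≈⟨ +-congˡ (trans (+-comm _ _) (nonsquare⇒x^m+1≈0 y≉0 nonsquare)) ⟩
      1# +ᶠ 0#                          ≈⟨ +-identityʳ 1# ⟩
      1#                                ∎

  P : ℕ → Carrier
  P k = Σ< n (λ j → s j · 1# *ᶠ α ^ᶠ (j * k))

  P-cong : ∀ {k l} → α ^ᶠ k ≈ α ^ᶠ l → P k ≈ P l
  P-cong {k} {l} eq = Σ<-cong n (λ j _ → *-congˡ {s j · 1#} (begin
    α ^ᶠ (j * k)    ≡⟨ ≡.cong (α ^ᶠ_) (ℕ.*-comm j k) ⟩
    α ^ᶠ (k * j)    ≈⟨ ^-assocʳ α k j ⟨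
    (α ^ᶠ k) ^ᶠ j   ≈⟨ ^-congˡ j eq ⟩
    (α ^ᶠ l) ^ᶠ j   ≈⟨ ^-assocʳ α l j ⟩
    α ^ᶠ (l * j)    ≡⟨ ≡.cong (α ^ᶠ_) (ℕ.*-comm l j) ⟩
    α ^ᶠ (j * l)    ∎))

  Σ-δ : ∀ k → Σ< n (λ j → δ (x j) *ᶠ α ^ᶠ (j * k)) ≈ α ^ᶠ (m * k)
  Σ-δ k = trans (Σ<-single (λ j → δ (x j) *ᶠ α ^ᶠ (j * k)) m<n vanish)
    (trans (*-congʳ δ≈1) (*-identityˡ _))
    where
    δ≈1 : δ (x m) ≈ 1#
    δ≈1 = reflexive (≡.cong (if_then 1# else 0#) (dec-true (x m ≈? 0#) α^m+1≈0))
    vanish : ∀ j → j < n → ¬ j ≡ m → δ (x j) *ᶠ α ^ᶠ (j * k) ≈ 0#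
    vanish j j<n j≢m = trans (*-congʳ (reflexive (≡.cong (if_then 1# else 0#) (dec-false (x j ≈? 0#) x≉0)))) (zeroˡ _)
      where
      x≉0 : x j ≉ 0#
      x≉0 x≈0 = j≢m (α^-injective j<n m<n (+-cancelʳ 1# _ _ (trans x≈0 (sym α^m+1≈0))))

  -- After expanding `x j ^ᶠ m` and exchanging the sums, the character sum at `k + a` kills every
  -- `k < q` except `k = l`, where it equals -1.
  Σ-x^m : ∀ {a l} → 0 < a → 0 < l → a + l ≡ n →
          Σ< n (λ j → x j ^ᶠ m *ᶠ α ^ᶠ (j * a)) +ᶠ coeff d l · 1# ≈ 0#
  Σ-x^m {a} {l} 0<a 0<l a+l≡n = begin
    Σ< n (λ j → x j ^ᶠ m *ᶠ α ^ᶠ (j * a)) +ᶠ b l ≈⟨ +-congʳ (Σ<-cong n λ j _ → expand j) ⟩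
    Σ< n (λ j → Σ< q (λ k → b k *ᶠ α ^ᶠ (j * (k + a)))) +ᶠ b l
      ≈⟨ +-congʳ (∑-comm {n} {q} (λ j k → b (toℕ k) *ᶠ α ^ᶠ (toℕ j * (toℕ k + a)))) ⟩
    Σ< q (λ k → Σ< n (λ j → b k *ᶠ α ^ᶠ (j * (k + a)))) +ᶠ b l
      ≈⟨ +-congʳ (Σ<-cong q λ k _ → *-distribˡ-sum {n} (b k) (λ j → α ^ᶠ (toℕ j * (k + a)))) ⟨
    Σ< q (λ k → b k *ᶠ character-sum (k + a)) +ᶠ b l
      ≈⟨ +-congʳ (Σ<-single (λ k → b k *ᶠ character-sum (k + a)) l<q vanish) ⟩
    b l *ᶠ character-sum (l + a) +ᶠ b l           ≈⟨ +-congˡ (*-identityʳ _) ⟨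
    b l *ᶠ character-sum (l + a) +ᶠ b l *ᶠ 1#     ≈⟨ distribˡ _ _ _ ⟨
    b l *ᶠ (character-sum (l + a) +ᶠ 1#)          ≈⟨ *-congˡ (trans (+-comm _ _) (1+character-sum≈0
                                                       (≡.subst (n ∣_) (≡.sym (≡.trans (ℕ.+-comm l a) a+l≡n)) ∣-refl))) ⟩
    b l *ᶠ 0#                                     ≈⟨ zeroʳ _ ⟩
    0#                                            ∎
    where
    b : ℕ → Carrier
    b k = coeff d k · 1#
    l<n : l < n
    l<n = ≡.subst (l <_) a+l≡n (ℕ.m<n+m l 0<a)
    l<q : l < q
    l<q = ≡.subst (l <_) (≡.sym q≡1+n) (ℕ.<-trans l<n (ℕ.n<1+n n))
    expand : ∀ j → x j ^ᶠ m *ᶠ α ^ᶠ (j * a) ≈ Σ< q (λ k → b k *ᶠ α ^ᶠ (j * (k + a)))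
    expand j = begin
      x j ^ᶠ m *ᶠ α ^ᶠ (j * a)
        ≈⟨ *-congʳ (half-power-expansion p≡1+h+h d (α ^ᶠ j)) ⟩
      Σ< q (λ k → coeff d k · ((α ^ᶠ j) ^ᶠ k)) *ᶠ α ^ᶠ (j * a)
        ≈⟨ *-distribʳ-sum {q} (α ^ᶠ (j * a)) _ ⟩
      Σ< q (λ k → coeff d k · ((α ^ᶠ j) ^ᶠ k) *ᶠ α ^ᶠ (j * a))
        ≈⟨ Σ<-cong q (λ k _ → term k) ⟩
      Σ< q (λ k → b k *ᶠ α ^ᶠ (j * (k + a)))    ∎
      where
      term : ∀ k → coeff d k · ((α ^ᶠ j) ^ᶠ k) *ᶠ α ^ᶠ (j * a) ≈ b k *ᶠ α ^ᶠ (j * (k + a))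
      term k = begin
        coeff d k · ((α ^ᶠ j) ^ᶠ k) *ᶠ α ^ᶠ (j * a) ≈⟨ *-congʳ (·≈·1* (coeff d k) _) ⟩
        b k *ᶠ (α ^ᶠ j) ^ᶠ k *ᶠ α ^ᶠ (j * a)        ≈⟨ *-assoc _ _ _ ⟩
        b k *ᶠ ((α ^ᶠ j) ^ᶠ k *ᶠ α ^ᶠ (j * a))      ≈⟨ *-congˡ (*-congʳ (^-assocʳ α j k)) ⟩
        b k *ᶠ (α ^ᶠ (j * k) *ᶠ α ^ᶠ (j * a))       ≈⟨ *-congˡ (^-homo-* α (j * k) (j * a)) ⟨
        b k *ᶠ α ^ᶠ (j * k + j * a)                 ≡⟨ ≡.cong (λ i → b k *ᶠ α ^ᶠ i) (ℕ.*-distribˡ-+ j k a) ⟨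
        b k *ᶠ α ^ᶠ (j * (k + a))                   ∎
    vanish : ∀ k → k < q → ¬ k ≡ l → b k *ᶠ character-sum (k + a) ≈ 0#
    vanish k k<q k≢l = trans (*-congˡ (character-sum≈0 n∤k+a)) (zeroʳ _)
      where
      -- 0 < k + a < 2 n
      n∤k+a : ¬ n ∣ k + a
      n∤k+a (divides zero eq) = ℕ.>⇒≢ 0<a (ℕ.m+n≡0⇒n≡0 k eq)
      n∤k+a (divides (suc zero) eq) = k≢l (ℕ.+-cancelʳ-≡ a k l
        (≡.trans eq (≡.trans (ℕ.+-identityʳ n) (≡.trans (≡.sym a+l≡n) (ℕ.+-comm a l)))))
      n∤k+a (divides (suc (suc r)) eq) = ℕ.<⇒≱ {k + a} {n + n} k+a<n+n
        (≡.subst (n + n ≤_) (≡.sym eq) (ℕ.+-monoʳ-≤ n (ℕ.m≤m+n n (r * n))))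
        where
        k+a<n+n : k + a < n + n
        k+a<n+n = ℕ.+-mono-≤-< (ℕ.≤-pred (≡.subst (k <_) q≡1+n k<q)) (≡.subst (a <_) a+l≡n (ℕ.m<m+n a 0<l))

  -- Sums `sequence-identity` against `α ^ᶠ (j * a)`. The constant 1 contributes a vanishing
  -- character sum since `0 < a < n`, `δ` contributes the sign `α ^ᶠ (m * a)`, and `Σ-x^m` trades
  -- `X` for the coefficient.
  spectrum : ∀ {a l} → 0 < a → 0 < l → a + l ≡ n → P a +ᶠ P a +ᶠ α ^ᶠ (m * a) ≈ coeff d l · 1#
  spectrum {a} {l} 0<a 0<l a+l≡n = +-cancelʳ X _ _ (begin
    P a +ᶠ P a +ᶠ α ^ᶠ (m * a) +ᶠ X     ≈⟨ +-assoc _ _ _ ⟩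
    P a +ᶠ P a +ᶠ (α ^ᶠ (m * a) +ᶠ X)   ≈⟨ +-congˡ (+-comm _ _) ⟩
    P a +ᶠ P a +ᶠ (X +ᶠ α ^ᶠ (m * a))   ≈⟨ +-assoc _ _ _ ⟨
    P a +ᶠ P a +ᶠ X +ᶠ α ^ᶠ (m * a)     ≈⟨ +-congˡ (Σ-δ a) ⟨
    P a +ᶠ P a +ᶠ X +ᶠ D                ≈⟨ +-congʳ (+-congʳ (∑-distrib-+ {n} _ _)) ⟨
    Σ< n (λ j → p₁ j +ᶠ p₁ j) +ᶠ X +ᶠ D ≈⟨ +-congʳ (∑-distrib-+ {n} _ _) ⟨
    Σ< n (λ j → p₁ j +ᶠ p₁ j +ᶠ x₁ j) +ᶠ D ≈⟨ ∑-distrib-+ {n} _ _ ⟨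
    Σ< n (λ j → p₁ j +ᶠ p₁ j +ᶠ x₁ j +ᶠ δ₁ j) ≈⟨ Σ<-cong n collect ⟩
    character-sum a                     ≈⟨ character-sum≈0 (>⇒∤ {{>-nonZero 0<a}} a<n) ⟩
    0#                                  ≈⟨ Σ-x^m 0<a 0<l a+l≡n ⟨
    X +ᶠ coeff d l · 1#                 ≈⟨ +-comm _ _ ⟩
    coeff d l · 1# +ᶠ X                 ∎)
    where
    p₁ x₁ δ₁ : ℕ → Carrier
    p₁ j = s j · 1# *ᶠ α ^ᶠ (j * a)
    x₁ j = x j ^ᶠ m *ᶠ α ^ᶠ (j * a)
    δ₁ j = δ (x j) *ᶠ α ^ᶠ (j * a)
    X = Σ< n x₁
    D = Σ< n δ₁
    a<n : a < n
    a<n = ≡.subst (a <_) a+l≡n (ℕ.m<m+n a 0<l)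
    collect : ∀ j → j < n → p₁ j +ᶠ p₁ j +ᶠ x₁ j +ᶠ δ₁ j ≈ α ^ᶠ (j * a)
    collect j j<n = begin
      p₁ j +ᶠ p₁ j +ᶠ x₁ j +ᶠ δ₁ j      ≈⟨ +-congʳ (+-congʳ (distribʳ _ _ _)) ⟨
      (s j · 1# +ᶠ s j · 1#) *ᶠ α ^ᶠ (j * a) +ᶠ x₁ j +ᶠ δ₁ j ≈⟨ +-congʳ (distribʳ _ _ _) ⟨
      (s j · 1# +ᶠ s j · 1# +ᶠ x j ^ᶠ m) *ᶠ α ^ᶠ (j * a) +ᶠ δ₁ j ≈⟨ distribʳ _ _ _ ⟨
      (s j · 1# +ᶠ s j · 1# +ᶠ x j ^ᶠ m +ᶠ δ (x j)) *ᶠ α ^ᶠ (j * a) ≈⟨ *-congʳ (sequence-identity j j<n) ⟩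
      1# *ᶠ α ^ᶠ (j * a)                ≈⟨ *-identityˡ _ ⟩
      α ^ᶠ (j * a)                      ∎

  s∈01 : ∀ j → s j ≡ 0 ⊎ s j ≡ 1
  s∈01 j = cases (does ((x (j % n) ≈? 0#) ⊎-dec nonzeroSquare? (x (j % n))))
    where
    cases : ∀ b → (if b then 0 else 1) ≡ 0 ⊎ (if b then 0 else 1) ≡ 1
    cases true  = inj₁ ≡.refl
    cases false = inj₂ ≡.refl

  s-cong : ∀ {i j} → (s i ≡ 1 → s j ≡ 1) → (s j ≡ 1 → s i ≡ 1) → s i ≡ s j
  s-cong {i} {j} i⇒j j⇒i with s∈01 i | s∈01 j
  ... | inj₁ i≡0 | inj₁ j≡0 = ≡.trans i≡0 (≡.sym j≡0)
  ... | inj₁ _   | inj₂ j≡1 = ≡.trans (j⇒i j≡1) (≡.sym j≡1)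
  ... | inj₂ i≡1 | _        = ≡.trans i≡1 (≡.sym (i⇒j i≡1))

  α^[toℕ-mod] : ∀ i k → α ^ᶠ (toℕ (i mod n) * k) ≈ α ^ᶠ (i * k)
  α^[toℕ-mod] i k = begin
    α ^ᶠ (toℕ (i mod n) * k)    ≈⟨ ^-assocʳ α (toℕ (i mod n)) k ⟨
    (α ^ᶠ toℕ (i mod n)) ^ᶠ k   ≈⟨ ^-congˡ k (trans (^-congʳ α (toℕ-mod i)) (α^[i%n]≈α^i i)) ⟩
    (α ^ᶠ i) ^ᶠ k               ≈⟨ ^-assocʳ α i k ⟩
    α ^ᶠ (i * k)                ∎

  -- Units modulo the even number n are odd.
  α^[m*unit]≈α^m : ∀ {i j} → j ⊗ i ≡ 𝟙 → α ^ᶠ (m * toℕ i) ≈ α ^ᶠ m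
  α^[m*unit]≈α^m {i} {j} ji≡𝟙 with toℕ i % 2 | m≡m%n+[m/n]*n (toℕ i) 2 | m%n<n (toℕ i) 2
  ... | suc (suc _) | _ | s≤s (s≤s ())
  ... | suc zero | i≡ | _ = begin
    α ^ᶠ (m * toℕ i)              ≡⟨ ≡.cong (α ^ᶠ_) (≡.trans (≡.cong (m *_) i≡) (odd m k)) ⟩
    α ^ᶠ (m + k * (m + m))        ≈⟨ ^-homo-* α m (k * (m + m)) ⟩
    α ^ᶠ m *ᶠ α ^ᶠ (k * (m + m))  ≈⟨ *-congˡ (n∣i⇒α^i≈1 (divides k (≡.cong (k *_) (≡.sym n≡m+m)))) ⟩
    α ^ᶠ m *ᶠ 1#                  ≈⟨ *-identityʳ _ ⟩
    α ^ᶠ m                        ∎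
    where
    k = toℕ i / 2
    odd : ∀ m k → m * (1 + k * 2) ≡ m + k * (m + m)
    odd = solve-∀
  -- Were `toℕ i` even, `n` would divide `toℕ i * m`; cancelling the unit would leave `n` dividing
  -- `m`, although `0 < m < n`.
  ... | zero | i≡ | _ = contradiction
    (unit-cancel 1<n {i} {j} ji≡𝟙 {m} (divides k (≡.trans (≡.cong (_* m) i≡)
      (≡.trans (even k m) (≡.cong (k *_) (≡.sym n≡m+m))))))
    (>⇒∤ {{>-nonZero 0<m}} m<n)
    where
    k = toℕ i / 2
    even : ∀ k m → k * 2 * m ≡ k * (m + m)
    even = solve-∀

  -- A multiplier acting on the Fourier coefficients.

  module Multiplier (t u c : Fin n) (ut≡𝟙 : u ⊗ t ≡ 𝟙)
                    (tS≐S+c : Image (t ⊗_) (slceSet F α) ≐ Image (_⊕ c) (slceSet F α)) where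

    tu≡𝟙 : t ⊗ u ≡ 𝟙
    tu≡𝟙 = ≡.trans (⊗-comm t u) ut≡𝟙

    t⊗u⊗i≡i : ∀ i → t ⊗ (u ⊗ i) ≡ i
    t⊗u⊗i≡i i = ≡.trans (≡.sym (⊗-assoc t u i)) (≡.trans (≡.cong (_⊗ i) tu≡𝟙) (⊗-identityˡ i))

    u⊗t⊗i≡i : ∀ i → u ⊗ (t ⊗ i) ≡ i
    u⊗t⊗i≡i i = ≡.trans (≡.sym (⊗-assoc u t i)) (≡.trans (≡.cong (_⊗ i) ut≡𝟙) (⊗-identityˡ i))

    -- Chosen so that `t ⊗ π i` is `i ⊕ c`: the equality of sets tS = S + c then says that `s` is
    -- invariant under `π`.
    π π⁻¹ : Fin n → Fin n
    π i   = u ⊗ (i ⊕ c)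
    π⁻¹ i = (t ⊗ i) ⊕ ⊖ c

    π-permutation : Permutation.Permutation n n
    π-permutation = Permutation.permutation π π⁻¹
      (λ i → ≡.trans (≡.cong (u ⊗_) (i⊕⊖j⊕j≡i (t ⊗ i) c)) (u⊗t⊗i≡i i))
      (λ i → ≡.trans (≡.cong (_⊕ ⊖ c) (t⊗u⊗i≡i (i ⊕ c))) (i⊕j⊕⊖j≡i i c))

    s∘π : ∀ i → s (toℕ (π i)) ≡ s (toℕ i)
    s∘π i = s-cong {toℕ (π i)} {toℕ i} forward backward
      where
      forward : s (toℕ (π i)) ≡ 1 → s (toℕ i) ≡ 1
      forward πi∈S with j , j∈S , j+c≡i+c ← proj₁ tS≐S+c (π i , πi∈S , t⊗u⊗i≡i (i ⊕ c)) =
        ≡.subst (λ k → s (toℕ k) ≡ 1)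
          (≡.trans (≡.sym (i⊕j⊕⊖j≡i j c)) (≡.trans (≡.cong (_⊕ ⊖ c) j+c≡i+c) (i⊕j⊕⊖j≡i i c))) j∈S
      backward : s (toℕ i) ≡ 1 → s (toℕ (π i)) ≡ 1
      backward i∈S with j , j∈S , tj≡i+c ← proj₂ tS≐S+c (i , i∈S , ≡.refl) =
        ≡.subst (λ k → s (toℕ k) ≡ 1) (≡.trans (≡.sym (u⊗t⊗i≡i j)) (≡.cong (u ⊗_) tj≡i+c)) j∈S

    -- Reindexing by `π` preserves the values of `s` and turns the exponent `π i * (t * k)` into
    -- `(i + c) * k` modulo `n`.
    P-multiplier : ∀ k → P (toℕ t * k) ≈ α ^ᶠ (toℕ c * k) *ᶠ P k
    P-multiplier k = begin
      P (toℕ t * k)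
        ≈⟨ sum-permute {n} {n} (λ i → s (toℕ i) · 1# *ᶠ α ^ᶠ (toℕ i * (toℕ t * k))) π-permutation ⟩
      sum {n} (λ i → s (toℕ (π i)) · 1# *ᶠ α ^ᶠ (toℕ (π i) * (toℕ t * k)))
        ≈⟨ sum-cong-≋ {n} term ⟩
      sum {n} (λ i → α ^ᶠ (toℕ c * k) *ᶠ (s (toℕ i) · 1# *ᶠ α ^ᶠ (toℕ i * k)))
        ≈⟨ *-distribˡ-sum {n} _ _ ⟨
      α ^ᶠ (toℕ c * k) *ᶠ P k ∎
      where
      power : ∀ i → α ^ᶠ (toℕ (π i) * (toℕ t * k)) ≈ α ^ᶠ (toℕ c * k) *ᶠ α ^ᶠ (toℕ i * k)
      power i = begin
        α ^ᶠ (toℕ (π i) * (toℕ t * k))  ≡⟨ ≡.cong (α ^ᶠ_) (≡.trans (≡.sym (ℕ.*-assoc (toℕ (π i)) (toℕ t) k))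
                                             (≡.cong (_* k) (ℕ.*-comm (toℕ (π i)) (toℕ t)))) ⟩
        α ^ᶠ (toℕ t * toℕ (π i) * k)    ≈⟨ α^[toℕ-mod] (toℕ t * toℕ (π i)) k ⟨
        α ^ᶠ (toℕ (t ⊗ π i) * k)        ≡⟨ ≡.cong (λ j → α ^ᶠ (toℕ j * k)) (t⊗u⊗i≡i (i ⊕ c)) ⟩
        α ^ᶠ (toℕ (i ⊕ c) * k)          ≈⟨ α^[toℕ-mod] (toℕ i + toℕ c) k ⟩
        α ^ᶠ ((toℕ i + toℕ c) * k)      ≡⟨ ≡.cong (α ^ᶠ_) (≡.trans (ℕ.*-distribʳ-+ k (toℕ i) (toℕ c)) (ℕ.+-comm (toℕ i * k) (toℕ c * k))) ⟩
        α ^ᶠ (toℕ c * k + toℕ i * k)    ≈⟨ ^-homo-* α (toℕ c * k) (toℕ i * k) ⟩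
        α ^ᶠ (toℕ c * k) *ᶠ α ^ᶠ (toℕ i * k) ∎
      term : ∀ i → s (toℕ (π i)) · 1# *ᶠ α ^ᶠ (toℕ (π i) * (toℕ t * k)) ≈
                   α ^ᶠ (toℕ c * k) *ᶠ (s (toℕ i) · 1# *ᶠ α ^ᶠ (toℕ i * k))
      term i = trans (*-cong (reflexive (≡.cong (_· 1#) (s∘π i))) (power i)) (x*yz≈y*xz _ _ _)

    -- At a unit, where α ^ (m * a) = α ^ m = -1, a vanishing coefficient means 2 P(a) = 1.
    2P≈1 : ∀ {i j a} → j ⊗ i ≡ 𝟙 → toℕ i ≡ a → defect (leastPositive i) ℤ.> ℤ.+ 0 → P a +ᶠ P a ≈ 1#
    2P≈1 {i} {j} ji≡𝟙 ≡.refl defect>0 = +-cancelʳ (α ^ᶠ m) _ _ (begin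
      P a +ᶠ P a +ᶠ α ^ᶠ m        ≈⟨ +-congˡ (α^[m*unit]≈α^m {i} {j} ji≡𝟙) ⟨
      P a +ᶠ P a +ᶠ α ^ᶠ (m * a)  ≈⟨ spectrum 0<a 0<l a+l≡n ⟩
      coeff d l · 1#              ≈⟨ ∣⇒·≈0 p·1≈0 p∣coeff 1# ⟩
      0#                          ≈⟨ α^m+1≈0 ⟨
      α ^ᶠ m +ᶠ 1#                ≈⟨ +-comm _ _ ⟩
      1# +ᶠ α ^ᶠ m                ∎)
      where
      a = toℕ i
      l = n ∸ a
      a<n : a < n
      a<n = Fin.toℕ<n i
      0<a : 0 < a
      0<a = unit>0 1<n {i} {j} ji≡𝟙
      0<l : 0 < l
      0<l = ℕ.m<n⇒0<n∸m a<n
      a+l≡n : a + l ≡ n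
      a+l≡n = ℕ.m+[n∸m]≡n (ℕ.<⇒≤ a<n)
      p∣coeff : p ∣ coeff d l
      p∣coeff = defect>0⇒p∣coeff a+l≡n 0<l
        (≡.subst (λ b → defect b ℤ.> ℤ.+ 0) (leastPositive≡toℕ i 0<a) defect>0)

    module _ {w v y : Fin n} (w≡tv : w ≡ t ⊗ v) (yv≡𝟙 : y ⊗ v ≡ 𝟙)
             (defect-w>0 : defect (leastPositive w) ℤ.> ℤ.+ 0)
             (defect-v>0 : defect (leastPositive v) ℤ.> ℤ.+ 0) where

      P-invariant : ∀ k → P (toℕ t * k) ≈ P k
      P-invariant k = trans (P-multiplier k) (trans (*-congʳ (n∣i⇒α^i≈1 (∣m⇒∣m*n k n∣c))) (*-identityˡ _))
        where
        γ^v = α ^ᶠ (toℕ c * toℕ v)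
        -- `y` inverts `v` and `u` inverts `t`, so `y ⊗ u` inverts `w`, which is `t ⊗ v`.
        [yu]w≡𝟙 : (y ⊗ u) ⊗ w ≡ 𝟙
        [yu]w≡𝟙 = ≡.trans (⊗-assoc y u w) (≡.trans (≡.cong (y ⊗_)
          (≡.trans (≡.cong (u ⊗_) w≡tv) (u⊗t⊗i≡i v))) yv≡𝟙)
        2P[w]≈1 = 2P≈1 {w} {y ⊗ u} [yu]w≡𝟙 ≡.refl defect-w>0
        2P[v]≈1 = 2P≈1 {v} {y} yv≡𝟙 ≡.refl defect-v>0
        P[w]≈ : P (toℕ w) ≈ γ^v *ᶠ P (toℕ v)
        P[w]≈ = trans (P-cong (begin
          α ^ᶠ toℕ w              ≡⟨ ≡.cong (λ i → α ^ᶠ toℕ i) w≡tv ⟩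
          α ^ᶠ toℕ (t ⊗ v)        ≡⟨ ≡.cong (α ^ᶠ_) (toℕ-mod (toℕ t * toℕ v)) ⟩
          α ^ᶠ ((toℕ t * toℕ v) % n) ≈⟨ α^[i%n]≈α^i _ ⟩
          α ^ᶠ (toℕ t * toℕ v)    ∎)) (P-multiplier (toℕ v))
        γ^v≈1 : γ^v ≈ 1#
        γ^v≈1 = begin
          γ^v                                       ≈⟨ *-identityʳ _ ⟨
          γ^v *ᶠ 1#                                 ≈⟨ *-congˡ 2P[v]≈1 ⟨
          γ^v *ᶠ (P (toℕ v) +ᶠ P (toℕ v))           ≈⟨ distribˡ _ _ _ ⟩
          γ^v *ᶠ P (toℕ v) +ᶠ γ^v *ᶠ P (toℕ v)      ≈⟨ +-cong P[w]≈ P[w]≈ ⟨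
          P (toℕ w) +ᶠ P (toℕ w)                    ≈⟨ 2P[w]≈1 ⟩
          1#                                        ∎
        -- `γ^v≈1` says that `n` divides `c * v`, and the unit `v` cancels.
        n∣c : n ∣ toℕ c
        n∣c = unit-cancel 1<n {v} {y} yv≡𝟙 (≡.subst (n ∣_) (ℕ.*-comm (toℕ c) (toℕ v)) (α^i≈1⇒n∣i γ^v≈1))

      -- `spectrum` ties the coefficient at `l` to the frequency `a = n - l`, and `b = n - r` is
      -- `t * a` modulo `n`. `P-invariant` matches the Fourier coefficients and the oddness of `t`
      -- the signs, so both coefficients have the same image in the field.
      coeff-closed : ∀ {l r} z → 0 < l → l < n → ¬ p ∣ coeff d l →
                     0 < r → r < n → toℕ t * l ≡ r + z * n → ¬ p ∣ coeff d r
      coeff-closed {l} {r} z 0<l l<n p∤cₗ 0<r r<n tl≡ p∣cᵣ = p∤cₗ (·1≈0⇒∣ p-prime p·1≈0 (coeff d l) (begin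
        coeff d l · 1#              ≈⟨ spectrum 0<a 0<l a+l≡n ⟨
        P a +ᶠ P a +ᶠ α ^ᶠ (m * a)  ≈⟨ +-cong (+-cong P[b]≈P[a] P[b]≈P[a]) α^[mb]≈α^[ma] ⟨
        P b +ᶠ P b +ᶠ α ^ᶠ (m * b)  ≈⟨ spectrum 0<b 0<r b+r≡n ⟩
        coeff d r · 1#              ≈⟨ ∣⇒·≈0 p·1≈0 p∣cᵣ 1# ⟩
        0#                          ∎))
        where
        a b : ℕ
        a = n ∸ l
        b = n ∸ r
        0<a : 0 < a
        0<a = ℕ.m<n⇒0<n∸m l<n
        0<b : 0 < b
        0<b = ℕ.m<n⇒0<n∸m r<n
        a+l≡n : a + l ≡ n
        a+l≡n = ℕ.m∸n+n≡m (ℕ.<⇒≤ l<n)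
        b+r≡n : b + r ≡ n
        b+r≡n = ℕ.m∸n+n≡m (ℕ.<⇒≤ r<n)
        -- Multiplying either side by `α ^ᶠ (r + z * n)`, where `r + z * n` is `t * l`, makes the
        -- exponent a multiple of `n`.
        α^b≈α^ta : α ^ᶠ b ≈ α ^ᶠ (toℕ t * a)
        α^b≈α^ta = *-cancelˡ-≉0 (α^i≉0 (r + z * n)) (begin
          α ^ᶠ (r + z * n) *ᶠ α ^ᶠ b                ≈⟨ ^-homo-* α (r + z * n) b ⟨
          α ^ᶠ (r + z * n + b)                      ≈⟨ n∣i⇒α^i≈1 (divides (suc z) lemma₁) ⟩
          1#                                        ≈⟨ n∣i⇒α^i≈1 (divides (toℕ t) lemma₂) ⟨
          α ^ᶠ (r + z * n + toℕ t * a)              ≈⟨ ^-homo-* α (r + z * n) (toℕ t * a) ⟩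
          α ^ᶠ (r + z * n) *ᶠ α ^ᶠ (toℕ t * a)      ∎)
          where
          rearrange-+ : ∀ r x b → r + x + b ≡ (b + r) + x
          rearrange-+ = solve-∀
          lemma₁ : r + z * n + b ≡ suc z * n
          lemma₁ = ≡.trans (rearrange-+ r (z * n) b) (≡.cong (_+ z * n) b+r≡n)
          lemma₂ : r + z * n + toℕ t * a ≡ toℕ t * n
          lemma₂ = ≡.trans (≡.cong (_+ toℕ t * a) (≡.sym tl≡)) (≡.trans (≡.sym (ℕ.*-distribˡ-+ (toℕ t) l a))
            (≡.cong (toℕ t *_) (≡.trans (ℕ.+-comm l a) a+l≡n)))
        P[b]≈P[a] : P b ≈ P a
        P[b]≈P[a] = trans (P-cong α^b≈α^ta) (P-invariant a)
        α^[mb]≈α^[ma] : α ^ᶠ (m * b) ≈ α ^ᶠ (m * a)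
        α^[mb]≈α^[ma] = begin
          α ^ᶠ (m * b)                ≡⟨ ≡.cong (α ^ᶠ_) (ℕ.*-comm m b) ⟩
          α ^ᶠ (b * m)                ≈⟨ ^-assocʳ α b m ⟨
          (α ^ᶠ b) ^ᶠ m               ≈⟨ ^-congˡ m α^b≈α^ta ⟩
          (α ^ᶠ (toℕ t * a)) ^ᶠ m     ≈⟨ ^-assocʳ α (toℕ t * a) m ⟩
          α ^ᶠ (toℕ t * a * m)        ≡⟨ ≡.cong (α ^ᶠ_) (≡.trans (≡.cong (_* m) (ℕ.*-comm (toℕ t) a)) (swap a (toℕ t) m)) ⟩
          α ^ᶠ (m * toℕ t * a)        ≈⟨ ^-assocʳ α (m * toℕ t) a ⟨
          (α ^ᶠ (m * toℕ t)) ^ᶠ a     ≈⟨ ^-congˡ a (α^[m*unit]≈α^m {t} {u} ut≡𝟙) ⟩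
          (α ^ᶠ m) ^ᶠ a               ≈⟨ ^-assocʳ α m a ⟩
          α ^ᶠ (m * a)                ∎
          where
          swap : ∀ a t m → a * t * m ≡ m * t * a
          swap = solve-∀

      multiplier-is-power : ∃[ a ] toℕ t ≡ p ^ a
      multiplier-is-power = multiplier⇒power d>0 q≡1+n
        (≡.subst (toℕ t <_) (≡.sym q≡1+n) (ℕ.<-trans (Fin.toℕ<n t) (ℕ.n<1+n n)))
        (unit-cancel 1<n {t} {u} ut≡𝟙) coeff-closed (unit>0 1<n {t} {u} ut≡𝟙)

    module _ {ℓ′} {T : Pred (Fin n) ℓ′} (T-reps : IsCosetRepresentatives (p mod n) T) where

      -- As a power of `p`, `t` keeps `t ⊗ j` in the coset of `j`. Both lie in `T`, so they
      -- coincide, and the unit `j` cancels.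
      j,tj∈S₀⇒t≡𝟙 : ∀ {j} → j ∈ S₀ T → t ⊗ j ∈ S₀ T → t ≡ 𝟙
      j,tj∈S₀⇒t≡𝟙 {j} (j∈T , (w , wj≡𝟙 , jw≡𝟙) , defect-w>0)
                      (tj∈T , (v , _ , tjv≡𝟙) , defect-v>0) = fixes-unit⇒𝟙 {t} {j} {w} jw≡𝟙 j≡tj
        where
        t∈⟨p⟩ : t ∈ ⟨ p mod n ⟩
        t∈⟨p⟩ = power∈⟨⟩ (multiplier-is-power {w} {v} {t ⊗ j}
          (inverse-of-⊗ {t} {j} {v} {w} tjv≡𝟙 wj≡𝟙) tjv≡𝟙 defect-w>0 defect-v>0)

        j≡tj : j ≡ t ⊗ j
        j≡tj = IsCosetRepresentatives.distinct T-reps j∈T tj∈T (t , t∈⟨p⟩ , ⊗-comm j t)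

-- Halving `p - 1`, and the choice between equality and disjointness.

odd⇒≡1+h+h : ∀ {p} → ¬ (2 ∣ p) → ∃[ h ] p ≡ suc (h + h)
odd⇒≡1+h+h {p} 2∤p with p % 2 in p%2 | m≡m%n+[m/n]*n p 2 | m%n<n p 2
... | zero        | _  | _ = contradiction (m%n≡0⇒n∣m p 2 p%2) 2∤p
... | suc zero    | p≡ | _ = p / 2 , ≡.trans p≡ (≡.cong suc (k*2≡k+k (p / 2)))
  where
  k*2≡k+k : ∀ k → k * 2 ≡ k + k
  k*2≡k+k = solve-∀
... | suc (suc _) | _  | s≤s (s≤s ())

theorem4p2 : ∀ {c ℓ ℓ′} (p d : ℕ) (p-prime : Prime p) → ¬ (2 ∣ p) → (d>0 : 0 < d) →
    (let open SLCE p d p-prime d>0) →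
    (F : FiniteField c ℓ (p ^ d)) (α : FiniteField.Carrier F) → FiniteField.Primitive F α →
    (T : Pred (Fin n) ℓ′) → IsCosetRepresentatives (p mod n) T →
    (t : Fin n) → t ∈ T → IsMultiplier (slceSet F α) t →
    S₀ T ≐ Image (t ⊗_) (S₀ T) ⊎ S₀ T ⊥ Image (t ⊗_) (S₀ T)
theorem4p2 p d p-prime 2∤p d>0 F α α-primitive T T-reps t t∈T ((u , ut≡𝟙 , tu≡𝟙) , c , tS≐S+c)
  with h , p≡1+h+h ← odd⇒≡1+h+h 2∤p | t Fin.≟ SLCE.𝟙 p d p-prime d>0 {{SLCE.n-nonZero p d p-prime d>0}}
... | yes ≡.refl = inj₁
  ((λ {j} j∈S₀ → j , j∈S₀ , ⊗-identityˡ j) ,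
   (λ { (j , j∈S₀ , ≡.refl) → ≡.subst (S₀ T) (≡.sym (⊗-identityˡ j)) j∈S₀ }))
  where
  open SLCE p d p-prime d>0
  open ResidueProperties n
-- A common element has the form `t ⊗ j` with both `j` and `t ⊗ j` in `S₀`.
... | no t≢𝟙 = inj₂ λ { (tj∈S₀ , j , j∈S₀ , ≡.refl) →
        t≢𝟙 (j,tj∈S₀⇒t≡𝟙 t u c ut≡𝟙 tS≐S+c T-reps j∈S₀ tj∈S₀) }
  where
  open Spectrum {h = h} p-prime p≡1+h+h d>0 F α-primitive
  open Multiplier
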